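{- Let $n\ge 1$ be an integer, let $\mathrm{PF}_n$ be the set of parking functions of length $n$, and for $\pi\in \mathrm{PF}_n$ let $\mathrm{fix}(\pi)$ be the number of fixed points of $\pi$. Then, as polynomials in the indeterminate $q$, $$\sum_{\pi\in \mathrm{PF}_n} q^{\mathrm{fix}(\pi)}=\frac{1}{(n+1)^2} \left((q+n)^{n+1}-(q-1)^{n+1}\right).$$
   Context: A parking function of length $n$ is a sequence $\pi=(\pi_1,\dots,\pi_n)$ of positive integers such that, if $\lambda_1\le\cdots\le\lambda_n$ is the weakly increasing rearrangement of $\pi_1,\dots,\pi_n$, then $\lambda_i\le i$ for all $1\le i\le n$. An index $i\in\{1,\dots,n\}$ is a fixed point of $\pi$ if $\pi_i=i$. -}

module Defs where

open import Data.Fin.Base using (toℕ)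
open import Data.Integer.Base using (+_)
open import Data.List.Base using (List; []; _∷_; map; foldr; filter; applyUpTo; cartesianProductWith)
open import Data.List.Membership.Propositional using (_∈_)
open import Data.List.Membership.Propositional.Properties
  using (∈-applyUpTo⁺; ∈-cartesianProductWith⁺; ∈-filter⁺; ∈-filter⁻)
open import Data.List.Relation.Binary.Permutation.Propositional.Properties using (All-resp-↭)
open import Data.List.Relation.Binary.Pointwise using (Pointwise; []; _∷_; decidable)
open import Data.List.Relation.Unary.All as ListAll using ([]; _∷_)
open import Data.List.Relation.Unary.Any using (here)
open import Data.List.Relation.Unary.Unique.Propositional using (Unique)
open import Data.List.Relation.Unary.AllPairs using ([]; _∷_)
import Data.List.Relation.Unary.All.Properties as ListAllₚ
import Data.List.Relation.Unary.Unique.Propositional.Properties as Uniqueₚ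
import Data.List.Sort
open import Data.Nat.Base using (ℕ; zero; suc; _≤_; s≤s)
open import Data.Nat.Properties using (_≤?_; _≟_; ≤-decTotalOrder; ≤-trans; <⇒≢; suc-injective)
open import Data.Product.Base using (_×_; _,_; proj₂)
open import Data.Rational.Base as ℚ using (ℚ; 0ℚ; 1ℚ)
open import Data.Vec.Base using (Vec; []; _∷_; lookup; toList; count; allFin)
open import Data.Vec.Properties using (∷-injective)
open import Data.Vec.Relation.Unary.All as VecAll using (All; []; _∷_)
import Data.Vec.Relation.Unary.All.Properties as VecAllₚ
open import Function.Base using (_∘_)
open import Function.Bundles using (_⇔_; mk⇔)
open import Relation.Binary.PropositionalEquality.Core using (_≡_; refl)
open import Relation.Nullary.Decidable using (Dec; _×-dec_; map′)

open Data.List.Sort ≤-decTotalOrder using (sort; sort-↭)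

------------------------------------------------------------------------
-- Parking functions

-- Sequences are indexed from zero by Fin n, so position i stands for the
-- mathematical index suc (toℕ i), and applyUpTo suc n is 1, 2, …, n.

record IsParkingFunction {n : ℕ} (π : Vec ℕ n) : Set where
  constructor isParkingFunction
  field
    positive : All (1 ≤_) π
    bounded  : Pointwise _≤_ (sort (toList π)) (applyUpTo suc n)

open IsParkingFunction public

isParkingFunction? : ∀ {n} (π : Vec ℕ n) → Dec (IsParkingFunction π)
isParkingFunction? {n} π =
  map′ (λ (p , b) → isParkingFunction p b) (λ pf → positive pf , bounded pf)
    (VecAll.all? (1 ≤?_) π ×-dec decidable _≤?_ (sort (toList π)) (applyUpTo suc n))

words : List ℕ → (k : ℕ) → List (Vec ℕ k)
words xs zero    = [] ∷ []
words xs (suc k) = cartesianProductWith _∷_ xs (words xs k)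

-- The entries of a parking function of length n cannot exceed n, so only
-- words over {1, …, n} are searched; ∈-PF and PF-unique show that the list
-- contains every parking function of length n exactly once.
PF : (n : ℕ) → List (Vec ℕ n)
PF n = filter isParkingFunction? (words (applyUpTo suc n) n)

private
  ∈-words : ∀ {xs k} {π : Vec ℕ k} → All (_∈ xs) π → π ∈ words xs k
  ∈-words []       = here refl
  ∈-words (x ∷ πs) = ∈-cartesianProductWith⁺ _∷_ x (∈-words πs)

  words-unique : ∀ {xs} k → Unique xs → Unique (words xs k)
  words-unique zero    u = [] ∷ []
  words-unique (suc k) u =
    Uniqueₚ.cartesianProductWith⁺ _∷_ ∷-injective u (words-unique k u)

  All≤ : ∀ {m xs ys} → Pointwise _≤_ xs ys → ListAll.All (_≤ m) ys → ListAll.All (_≤ m) xs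
  All≤ []       []       = []
  All≤ (p ∷ ps) (q ∷ qs) = ≤-trans p q ∷ All≤ ps qs

  entries≤n : ∀ {n} {π : Vec ℕ n} → IsParkingFunction π → All (_≤ n) π
  entries≤n {n} {π} pf = VecAllₚ.toList⁻
    (All-resp-↭ (sort-↭ (toList π))
      (All≤ (bounded pf) (ListAllₚ.applyUpTo⁺₁ suc n λ i<n → i<n)))

  ∈-range : ∀ {n x} → 1 ≤ x × x ≤ n → x ∈ applyUpTo suc n
  ∈-range {x = suc x} (_ , x<n) = ∈-applyUpTo⁺ suc x<n

∈-PF : ∀ {n} {π : Vec ℕ n} → π ∈ PF n ⇔ IsParkingFunction π
∈-PF {n} = mk⇔ (proj₂ ∘ ∈-filter⁻ isParkingFunction? {xs = words (applyUpTo suc n) n})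
  λ pf → ∈-filter⁺ isParkingFunction?
    (∈-words (VecAll.map ∈-range (VecAll.zip (positive pf , entries≤n pf)))) pf

PF-unique : ∀ n → Unique (PF n)
PF-unique n = Uniqueₚ.filter⁺ isParkingFunction? (words-unique n
  (Uniqueₚ.applyUpTo⁺₁ suc n λ i<j _ → <⇒≢ i<j ∘ suc-injective))

fix : ∀ {n} → Vec ℕ n → ℕ
fix {n} π = count (λ i → lookup π i ≟ suc (toℕ i)) (allFin n)

------------------------------------------------------------------------
-- Polynomials in one indeterminate over ℚ

-- A polynomial is its list of coefficients, constant term first. Trailing
-- zeros are allowed, so equality of polynomials is _≈_ rather than _≡_.
Poly : Set
Poly = List ℚ

coeff : Poly → ℕ → ℚ
coeff []      _       = 0ℚ
coeff (a ∷ p) zero    = a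
coeff (a ∷ p) (suc k) = coeff p k

infix  4 _≈_
infixl 6 _+_ _-_
infixl 7 _*_ _·_
infixr 8 _^_

_≈_ : Poly → Poly → Set
p ≈ r = ∀ k → coeff p k ≡ coeff r k

const : ℚ → Poly
const a = a ∷ []

fromℕ : ℕ → Poly
fromℕ m = const (+ m ℚ./ 1)

q : Poly
q = 0ℚ ∷ 1ℚ ∷ []

_+_ : Poly → Poly → Poly
[]      + r       = r
(a ∷ p) + []      = a ∷ p
(a ∷ p) + (b ∷ r) = (a ℚ.+ b) ∷ (p + r)

_·_ : ℚ → Poly → Poly
c · p = map (c ℚ.*_) p

_-_ : Poly → Poly → Poly
p - r = p + map ℚ.-_ r

_*_ : Poly → Poly → Poly
[]      * r = []
(a ∷ p) * r = a · r + (0ℚ ∷ (p * r))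

_^_ : Poly → ℕ → Poly
p ^ zero  = const 1ℚ
p ^ suc k = p * p ^ k

∑ : ∀ {A : Set} → List A → (A → Poly) → Poly
∑ xs f = foldr (λ x s → f x + s) [] xs

{-# OPTIONS --safe #-}

-- Write q = 1 + x, so that q^fix(π) = Σ_S x^|S| over the sets S of fixed
-- points of π. Being a parking function is invariant under permuting positions,
-- so for given S the fixed letters may be moved to the front: the sum becomes
-- Σ_S x^|S| #{w : S ++ w parking}, with w a free word of length n − |S|. Here S
-- may range over all subsets of ℤ/(n+1), with 1,…,n as the parking letters, as
-- no parking function contains 0. Now the sum is invariant under rotating the
-- letters, and by the cycle lemma (Pollak) exactly one of the n+1 rotations of a
-- word of length n is parking. Hence n+1 times the sum is
-- Σ_{S ≠ ℤ/(n+1)} x^|S| (n+1)^(n−|S|), and multiplying by n+1 once more gives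
-- (x + n + 1)^(n+1) − x^(n+1).

module Submission where

open import Algebra.Bundles using (CommutativeMonoid)
open import Algebra.Morphism.Structures using (IsMonoidHomomorphism)
import Algebra.Properties.CommutativeMonoid.Mult
import Algebra.Properties.CommutativeSemigroup
open import Data.Bool.Base using (if_then_else_)
open import Data.Empty using (⊥-elim)
open import Data.Fin.Base as Fin using (Fin; toℕ)
import Data.Integer.Properties as ℤ
open import Data.List.Base
  using (List; []; _∷_; _++_; map; foldr; filter; length; upTo; applyUpTo; cartesianProductWith)
open import Data.List.Membership.Propositional using (_∈_)
open import Data.List.Membership.Propositional.Properties
  using (∈-cartesianProductWith⁻; ∈-upTo⁺; ∈-upTo⁻)
open import Data.List.Properties
  using (length-++; length-applyUpTo; length-upTo; map-++; map-applyUpTo; upTo-∷ʳ;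
         filter-accept; filter-none; filter-reject)
open import Data.List.Relation.Binary.Permutation.Propositional using (_↭_; ↭-trans; ↭-reflexive; ↭-sym)
open import Data.List.Relation.Binary.Permutation.Propositional.Properties
  using (map⁺; ++⁺ʳ; filter-↭; shift; ↭-length; ∷↭∷ʳ)
open import Data.List.Relation.Binary.Pointwise using (Pointwise; []; _∷_)
open import Data.List.Relation.Unary.All as All using (All; []; _∷_)
import Data.List.Relation.Unary.All.Properties as Allₚ
open import Data.List.Relation.Unary.AllPairs using (AllPairs; []; _∷_)
open import Data.List.Relation.Unary.Any using (here; there)
open import Data.List.Relation.Unary.Sorted.TotalOrder.Properties using (Sorted⇒AllPairs)
open import Data.List.Relation.Unary.Unique.Propositional using (Unique)
import Data.List.Relation.Unary.Unique.Propositional.Properties as Uniqueₚ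
import Data.List.Sort
open import Data.Nat.Base as ℕ using (ℕ; zero; suc; _≤_)
open import Data.Nat.GeneralisedArithmetic using (fold)
open import Data.Nat.ListAction using (sum)
open import Data.Nat.ListAction.Properties using (sum-↭)
import Data.Nat.Properties as ℕ
open import Data.Nat.Tactic.RingSolver using (solve-∀)
open import Data.Product.Base using (∃; _,_)
open import Data.Rational.Base as ℚ using (ℚ; 0ℚ; 1ℚ; _/_; toℚᵘ)
import Data.Rational.Properties as ℚ
open import Data.Rational.Solver using (module +-*-Solver)
open import Data.Rational.Unnormalised.Base as ℚᵘ using (mkℚᵘ; *≡*)
import Data.Rational.Unnormalised.Properties as ℚᵘ
open import Data.Sum.Base using (inj₁; inj₂)
open import Data.Vec.Base using (Vec; []; _∷_; lookup; toList; count; allFin; tabulate)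
open import Data.Vec.Membership.Propositional using () renaming (_∈_ to _∈ᵥ_)
open import Data.Vec.Properties using (length-toList)
import Data.Vec.Relation.Unary.All as VecAll
import Data.Vec.Relation.Unary.All.Properties as VecAllₚ
import Data.Vec.Relation.Unary.Any as VecAny
open import Defs using (IsParkingFunction; isParkingFunction; isParkingFunction?; words; fix)
open import Function.Base using (_∘_; id)
open import Level using (0ℓ)
open import Relation.Binary.Definitions using (tri<; tri≈; tri>)
open import Relation.Binary.PropositionalEquality as ≡ using (_≡_; _≢_; refl; cong)
open import Relation.Nullary using (Dec; yes; no; does; ¬_; contradiction)
open import Relation.Nullary.Decidable using (map′)
open import Relation.Unary using (Pred; Decidable)

-- Rotating the letters of π changes the values but not the positions, so it does not preserve fixed
-- points, and the cycle lemma cannot be applied to the sum of q^fix directly. Expanding in x helps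
-- because S only prescribes some fixed points and leaves the remaining positions unconstrained;
-- once S is gathered in front, positions no longer matter. The set {1,...,n} is not stable under
-- rotation, which is why 0 must be available to S. The second factor n+1 raises the weight of S to
-- (n+1)^(n+1-|S|), its weight in the binomial expansion of (n+1+x)^(n+1). The one term still
-- missing there, for S = ℤ/(n+1), is x^(n+1). The combinatorics takes place in a commutative
-- monoid: x is an additive endomorphism `X`, integer factors are repeated addition, and powers are
-- iterates `fold`. The resulting identity is therefore stated as a sum; subtraction and division
-- enter only for coefficients in ℚ.

mapⁿ : ∀ {a} {A : Set a} → (A → A) → ℕ → List A → List A
mapⁿ s zero    w = w
mapⁿ s (suc t) w = mapⁿ s t (map s w)

mapⁿ-↭ : ∀ {a} {A : Set a} (s : A → A) t {v w} → v ↭ w → mapⁿ s t v ↭ mapⁿ s t w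
mapⁿ-↭ s zero    v↭w = v↭w
mapⁿ-↭ s (suc t) v↭w = mapⁿ-↭ s t (map⁺ s v↭w)

-- Rotations of words and the cycle lemma

module Rotations where

  open import Data.Nat.Base
  open import Data.Nat.Properties
  open import Data.Product.Base using (_×_)
  open ≡
  open Data.List.Sort ≤-decTotalOrder using (sort; sort-↭; sort-↗)

  module CycleLemma (n : ℕ) (A : ℕ → ℕ) (A-period : ∀ u → A (suc n + u) ≡ n + A u) where

    -- Good u says that the level A v − v is minimal at v = u on the window
    -- u, …, u + n. The level drops by one over a period, so only the first
    -- minimum within a period is good.
    Good : ℕ → Set
    Good u = ∀ {s} → s < suc n → A u + s ≤ A (u + s)

    private
      -- This is transitivity for the levels a - x ≤ b - y ≤ c - z, with the subtractions moved
      -- across since levels may be negative. Taking a successor for `a` gives the strict version.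
      ≤-level-trans : ∀ {a b c x y z} → a + y ≤ b + x → b + z ≤ c + y → a + z ≤ c + x
      ≤-level-trans {a} {b} {c} {x} {y} {z} p r = +-cancelʳ-≤ (b + y) (a + z) (c + x) (begin
        a + z + (b + y)   ≡⟨ lemma a b y z ⟩
        (a + y) + (b + z) ≤⟨ +-mono-≤ p r ⟩
        (b + x) + (c + y) ≡⟨ lemma′ b c x y ⟩
        c + x + (b + y)   ∎)
        where
        open ≤-Reasoning
        lemma : ∀ a b y z → a + z + (b + y) ≡ (a + y) + (b + z)
        lemma = solve-∀
        lemma′ : ∀ b c x y → (b + x) + (c + y) ≡ c + x + (b + y)
        lemma′ = solve-∀

      record FirstMin (m u : ℕ) : Set where
        field
          bound  : u ≤ m
          before : ∀ {s} → s < u → A u + s < A s + u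
          after  : ∀ {s} → u ≤ s → s ≤ m → A u + s ≤ A s + u

      open FirstMin

      -- A new endpoint displaces u only if its level is strictly lower, so the earliest minimum is
      -- kept.
      firstMin : ∀ m → ∃ (FirstMin m)
      firstMin zero = 0 , record
        { bound = z≤n ; before = λ () ; after = λ { _ z≤n → ≤-refl } }
      firstMin (suc m) with firstMin m
      ... | u , min with A u + suc m ≤? A (suc m) + u
      ...   | yes p = u , record
        { bound  = m≤n⇒m≤1+n (bound min)
        ; before = before min
        ; after  = λ {s} u≤s s≤1+m → aft u≤s (m≤n⇒m<n∨m≡n s≤1+m) }
        where
        aft : ∀ {s} → u ≤ s → _ → A u + s ≤ A s + u
        aft u≤s (inj₁ (s≤s s≤m)) = after min u≤s s≤m
        aft u≤s (inj₂ refl)      = p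
      ...   | no ¬p = suc m , record
        { bound  = ≤-refl
        ; before = λ {s} s<1+m → bef s (≤-pred s<1+m) (s <? u)
        ; after  = λ m<s s≤1+m → aft (≤-antisym s≤1+m m<s) }
        where
        aft : ∀ {s} → s ≡ suc m → A (suc m) + s ≤ A s + suc m
        aft refl = ≤-refl
        bef : ∀ s → s ≤ m → Dec (s < u) → A (suc m) + s < A s + suc m
        bef s s≤m (yes s<u) = ≤-level-trans {b = A u} {y = u} (≰⇒> ¬p) (<⇒≤ (before min s<u))
        bef s s≤m (no s≮u)  = ≤-level-trans {b = A u} {y = u} (≰⇒> ¬p) (after min (≮⇒≥ s≮u) s≤m)

    exists-good : ∃ λ u → u ≤ n × Good u
    exists-good with firstMin n
    ... | u , min = u , bound min , λ {s} s<N → good s s<N (u + s ≤? n)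
      where
      good : ∀ s → s < suc n → Dec (u + s ≤ n) → A u + s ≤ A (u + s)
      good s _ (yes u+s≤n) = +-cancelʳ-≤ u (A u + s) (A (u + s)) (begin
        A u + s + u     ≡⟨ lemma (A u) s u ⟩
        A u + (u + s)   ≤⟨ after min (m≤m+n u s) u+s≤n ⟩
        A (u + s) + u   ∎)
        where
        open ≤-Reasoning
        lemma : ∀ a s u → a + s + u ≡ a + (u + s)
        lemma = solve-∀
      -- Beyond n the window wraps around to w < u. There the level is strictly above that of u,
      -- which absorbs the drop by one over a period.
      good s s<N (no u+s≰n) = +-cancelʳ-≤ u (A u + s) (A (u + s)) (begin
        A u + s + u            ≡⟨ trans (+-assoc (A u) s u) (cong (A u +_) (trans (+-comm s u) (sym eq))) ⟩
        A u + (suc n + w)      ≡⟨ lemma (A u) n w ⟩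
        suc (A u + w) + n      ≤⟨ +-monoˡ-≤ n (before min w<u) ⟩
        A w + u + n            ≡⟨ lemma′ (A w) u n ⟩
        n + A w + u            ≡⟨ cong (_+ u) (trans (sym (A-period w)) (cong A eq)) ⟩
        A (u + s) + u          ∎)
        where
        open ≤-Reasoning
        w = u + s ∸ suc n
        eq : suc n + w ≡ u + s
        eq = m+[n∸m]≡n (≰⇒> u+s≰n)
        w<u : w < u
        w<u = +-cancelˡ-< (suc n) w u (subst₂ _<_ (sym eq) (+-comm u (suc n)) (+-monoʳ-< u s<N))
        lemma : ∀ a n w → a + (suc n + w) ≡ suc (a + w) + n
        lemma = solve-∀
        lemma′ : ∀ a u n → a + u + n ≡ n + a + u
        lemma′ = solve-∀

    private
      -- The window of u contains v and the window of v contains u + n + 1. The level would thus not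
      -- decrease from u to u + n + 1, yet it drops by one over a period.
      ¬two-good : ∀ {u v} → u < v → v ≤ n → Good u → ¬ Good v
      ¬two-good {u} {v} u<v v≤n good-u good-v = <-irrefl refl (begin-strict
        A u + n             ≡⟨ cong (A u +_) (suc-injective eq) ⟨
        A u + (d + e)       <⟨ ≤-reflexive (lemma (A u) d e) ⟩
        A u + suc d + e     ≤⟨ +-monoˡ-≤ e (good-u {suc d} (s≤s d<n)) ⟩
        A (u + suc d) + e   ≡⟨ cong (λ w → A w + e) u+d≡v ⟩
        A v + e             ≤⟨ good-v e<N ⟩
        A (v + e)           ≡⟨ cong A v+e≡N+u ⟩
        A (suc n + u)       ≡⟨ A-period u ⟩
        n + A u             ≡⟨ +-comm n (A u) ⟩
        A u + n             ∎)
        where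
        open ≤-Reasoning
        d = v ∸ suc u
        e = n ∸ d
        u+d≡v : u + suc d ≡ v
        u+d≡v = trans (+-suc u d) (m+[n∸m]≡n u<v)
        d<n : d < n
        d<n = ≤-trans (m≤n+m (suc d) u) (≤-trans (≤-reflexive u+d≡v) v≤n)
        eq : suc d + e ≡ suc n
        eq = cong suc (m+[n∸m]≡n (<⇒≤ d<n))
        e<N : e < suc n
        e<N = s≤s (m∸n≤m n d)
        v+e≡N+u : v + e ≡ suc n + u
        v+e≡N+u = trans (cong (_+ e) (sym u+d≡v)) (trans (+-assoc u (suc d) e)
          (trans (cong (u +_) eq) (+-comm u (suc n))))
        lemma : ∀ a d e → suc (a + (d + e)) ≡ a + suc d + e
        lemma = solve-∀

    good-unique : ∀ {u v} → u ≤ n → v ≤ n → Good u → Good v → u ≡ v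
    good-unique {u} {v} u≤n v≤n good-u good-v with <-cmp u v
    ... | tri< u<v _ _ = ⊥-elim (¬two-good u<v v≤n good-u good-v)
    ... | tri≈ _ u≡v _ = u≡v
    ... | tri> _ _ v<u = ⊥-elim (¬two-good v<u u≤n good-v good-u)

  -- The bound on the sorted word, as counts of small letters

  count≤ : ℕ → List ℕ → ℕ
  count≤ i w = length (filter (_≤? i) w)

  private
    count≤-∷ : ∀ {i x} w → x ≤ i → count≤ i (x ∷ w) ≡ suc (count≤ i w)
    count≤-∷ {i} w x≤i = cong length (filter-accept (_≤? i) {xs = w} x≤i)

    count≤-∷-reject : ∀ {i x} w → ¬ x ≤ i → count≤ i (x ∷ w) ≡ count≤ i w
    count≤-∷-reject {i} w x≰i = cong length (filter-reject (_≤? i) {xs = w} x≰i)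

    -- The bound `f` is arbitrary because the tail of `applyUpTo f m` uses `f ∘ suc`; only `suc` is
    -- wanted in the end.
    count≤-pointwise : ∀ (f : ℕ → ℕ) → (∀ {i j} → i ≤ j → f i ≤ f j) → ∀ {m w} →
      Pointwise _≤_ w (applyUpTo f m) → ∀ {i} → i < m → suc i ≤ count≤ (f i) w
    count≤-pointwise f mono {suc m} {x ∷ w} (p ∷ ps) {zero} _ =
      ≤-trans (s≤s z≤n) (≤-reflexive (sym (count≤-∷ w p)))
    count≤-pointwise f mono {suc m} {x ∷ w} (p ∷ ps) {suc i} (s≤s i<m) =
      ≤-trans (s≤s (count≤-pointwise (f ∘ suc) (mono ∘ s≤s) ps i<m))
        (≤-reflexive (sym (count≤-∷ w (≤-trans p (mono z≤n)))))

    pointwise-count≤ : ∀ (f : ℕ → ℕ) {m w} → AllPairs _≤_ w → length w ≡ m →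
      (∀ {i} → i < m → suc i ≤ count≤ (f i) w) → Pointwise _≤_ w (applyUpTo f m)
    pointwise-count≤ f {w = []} [] refl h = []
    pointwise-count≤ f {w = x ∷ w} (x≤w ∷ sorted) refl h =
      x≤f0 (x ≤? f 0) ∷ pointwise-count≤ (f ∘ suc) sorted refl
        λ {i} i<m → ≤-pred (≤-trans (h (s≤s i<m)) (count≤-suc (f (suc i)) x w))
      where
      x≤f0 : Dec (x ≤ f 0) → x ≤ f 0
      x≤f0 (yes p) = p
      -- The head is the least entry: were it above `f 0`, all entries would be, and the count at
      -- `f 0` would be 0.
      x≤f0 (no ¬p) = contradiction (h (s≤s z≤n)) (<⇒≱ (s≤s (≤-reflexive (cong length
        (filter-none (_≤? f 0) (¬p ∷ All.map (λ x≤y y≤f0 → ¬p (≤-trans x≤y y≤f0)) x≤w))))))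
      count≤-suc : ∀ i x w → count≤ i (x ∷ w) ≤ suc (count≤ i w)
      count≤-suc i x w with x ≤? i
      ... | yes p = ≤-reflexive (count≤-∷ w p)
      ... | no ¬p = ≤-trans (≤-reflexive (count≤-∷-reject w ¬p)) (n≤1+n _)

  sorted-bounded⇒count : ∀ {n w} → Pointwise _≤_ (sort w) (applyUpTo suc n) →
    ∀ {i} → i < n → suc i ≤ count≤ (suc i) w
  sorted-bounded⇒count {w = w} b {i} i<n = ≤-trans (count≤-pointwise suc s≤s b i<n)
    (≤-reflexive (↭-length (filter-↭ (_≤? suc i) (sort-↭ w))))

  count⇒sorted-bounded : ∀ {w} → (∀ {i} → i < length w → suc i ≤ count≤ (suc i) w) →
    Pointwise _≤_ (sort w) (applyUpTo suc (length w))
  count⇒sorted-bounded {w} h =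
    pointwise-count≤ suc (Sorted⇒AllPairs ≤-totalOrder (sort-↗ w)) (↭-length (sort-↭ w))
      λ {i} i<n → ≤-trans (h i<n) (≤-reflexive (sym (↭-length (filter-↭ (_≤? suc i) (sort-↭ w)))))

  -- Rotation of letters and parking words

  module Rotation (n : ℕ) where

    rotate : ℕ → ℕ
    rotate zero    = n
    rotate (suc x) = x

    rotateⁿ : ℕ → List ℕ → List ℕ
    rotateⁿ = mapⁿ rotate

    -- The number of the letters x, rotate x, …, rotateⁱ⁻¹ x that are zero.
    hits : ℕ → ℕ → ℕ
    hits x       zero    = 0
    hits zero    (suc i) = suc (hits n i)
    hits (suc x) (suc i) = hits x i

    totalHits : List ℕ → ℕ → ℕ
    totalHits w i = sum (map (λ x → hits x i) w)

    private
      hits-+ : ∀ m x i → hits (m + x) (m + i) ≡ hits x i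
      hits-+ zero    x i = refl
      hits-+ (suc m) x i = hits-+ m x i

      -- After x steps the letter is 0, which is the one hit; the next letter is n, and n - x
      -- further steps lead back to x.
      hits-period : ∀ {x} → x ≤ n → ∀ i → hits x (suc n + i) ≡ suc (hits x i)
      hits-period {x} x≤n i = begin
        hits x (suc n + i)            ≡⟨ cong₂ hits (sym (+-identityʳ x)) eq ⟩
        hits (x + 0) (x + suc (d + i)) ≡⟨ hits-+ x 0 (suc (d + i)) ⟩
        suc (hits n (d + i))          ≡⟨ cong (λ m → suc (hits m (d + i))) (sym (m∸n+n≡m x≤n)) ⟩
        suc (hits (d + x) (d + i))    ≡⟨ cong suc (hits-+ d x i) ⟩
        suc (hits x i)                ∎
        where
        open ≡-Reasoning
        d = n ∸ x
        eq : suc n + i ≡ x + suc (d + i)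
        eq = trans (cong (λ m → suc m + i) (sym (m+[n∸m]≡n x≤n))) (lemma x d i)
          where
          lemma : ∀ x d i → suc (x + d) + i ≡ x + suc (d + i)
          lemma = solve-∀

      hits-late : ∀ {x i} → i ≤ x → hits x i ≡ 0
      hits-late {x} {i} i≤x = trans (cong₂ hits (sym (m+[n∸m]≡n i≤x)) (sym (+-identityʳ i)))
        (hits-+ i (x ∸ i) 0)

      hits-early : ∀ {x i} → x < i → i ≤ suc n → hits x i ≡ 1
      hits-early {zero}  {suc i} _         (s≤s i≤n) = cong suc (hits-late i≤n)
      hits-early {suc x} {suc i} (s≤s x<i) 1+i≤N     = hits-early x<i (≤-trans (n≤1+n i) 1+i≤N)

      hits-rotate : ∀ x i → hits x (suc i) ≡ hits x 1 + hits (rotate x) i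
      hits-rotate zero    i = refl
      hits-rotate (suc x) i = refl

    totalHits-0 : ∀ w → totalHits w 0 ≡ 0
    totalHits-0 []      = refl
    totalHits-0 (x ∷ w) = totalHits-0 w

    totalHits-rotate : ∀ w i → totalHits w (suc i) ≡ totalHits w 1 + totalHits (map rotate w) i
    totalHits-rotate []      i = refl
    totalHits-rotate (x ∷ w) i = trans (cong₂ _+_ (hits-rotate x i) (totalHits-rotate w i))
      (lemma (hits x 1) (hits (rotate x) i) (totalHits w 1) (totalHits (map rotate w) i))
      where
      lemma : ∀ a b c d → a + b + (c + d) ≡ a + c + (b + d)
      lemma = solve-∀

    totalHits-rotateⁿ : ∀ t w i → totalHits w (t + i) ≡ totalHits w t + totalHits (rotateⁿ t w) i
    totalHits-rotateⁿ zero    w i = cong (_+ totalHits w i) (sym (totalHits-0 w))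
    totalHits-rotateⁿ (suc t) w i = begin
      totalHits w (suc (t + i))                            ≡⟨ totalHits-rotate w (t + i) ⟩
      totalHits w 1 + totalHits w′ (t + i)                 ≡⟨ cong (totalHits w 1 +_) (totalHits-rotateⁿ t w′ i) ⟩
      totalHits w 1 + (totalHits w′ t + rest)              ≡⟨ +-assoc (totalHits w 1) _ rest ⟨
      totalHits w 1 + totalHits w′ t + rest                ≡⟨ cong (_+ rest) (totalHits-rotate w t) ⟨
      totalHits w (suc t) + rest                           ∎
      where
      open ≡-Reasoning
      w′ = map rotate w
      rest = totalHits (rotateⁿ (suc t) w) i

    totalHits-period : ∀ {w} → All (_≤ n) w → ∀ i → totalHits w (suc n + i) ≡ length w + totalHits w i
    totalHits-period []                  i = refl
    totalHits-period {x ∷ w} (x≤n ∷ w≤n) i =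
      trans (cong₂ _+_ (hits-period x≤n i) (totalHits-period w≤n i))
        (lemma (hits x i) (length w) (totalHits w i))
      where
      lemma : ∀ a b c → suc a + (b + c) ≡ suc b + (a + c)
      lemma = solve-∀

    -- Among its first i + 1 rotations, at most a full period, a letter x vanishes once if x ≤ i and
    -- never otherwise. This ties the cycle lemma to the counting form of the parking condition.
    totalHits-count : ∀ w {i} → i ≤ n → totalHits w (suc i) ≡ count≤ i w
    totalHits-count []      i≤n = refl
    totalHits-count (x ∷ w) {i} i≤n with x ≤? i
    ... | yes x≤i = trans
      (cong₂ _+_ (hits-early (s≤s x≤i) (s≤s i≤n)) (totalHits-count w i≤n)) (sym (count≤-∷ w x≤i))
    ... | no  x≰i = trans
      (cong₂ _+_ (hits-late (≰⇒> x≰i)) (totalHits-count w i≤n)) (sym (count≤-∷-reject w x≰i))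

    -- Since totalHits w 1 is the number of zeros in w, for words of length n
    -- the case s = n excludes zeros, and the others bound the sorted entries.
    Parking : List ℕ → Set
    Parking w = ∀ s → s < suc n → totalHits w 1 + s ≤ totalHits w (suc s)

    parking? : ∀ w → Dec (Parking w)
    parking? w = map′ (λ p s → p {s}) (λ p {s} → p s)
      (allUpTo? (λ s → totalHits w 1 + s ≤? totalHits w (suc s)) (suc n))

    parking-↭ : ∀ {v w} → v ↭ w → Parking v → Parking w
    parking-↭ {v} {w} v↭w p s s<N = subst₂ (λ a b → a + s ≤ b) (eq 1) (eq (suc s)) (p s s<N)
      where
      eq : ∀ i → totalHits v i ≡ totalHits w i
      eq i = sum-↭ (map⁺ (λ x → hits x i) v↭w)

    -- Over a full period every letter is hit exactly once, so at s = n the right side is just n.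
    parking⇒no-zeros : ∀ {w} → All (_≤ n) w → length w ≡ n → Parking w → totalHits w 1 ≡ 0
    parking⇒no-zeros {w} w≤n refl p = n≤0⇒n≡0 (+-cancelʳ-≤ (length w) (totalHits w 1) 0
      (≤-trans (p (length w) ≤-refl) (≤-reflexive (begin
        totalHits w (suc n)            ≡⟨ cong (totalHits w) (+-identityʳ (suc n)) ⟨
        totalHits w (suc n + 0)        ≡⟨ totalHits-period w≤n 0 ⟩
        n + totalHits w 0              ≡⟨ cong (n +_) (totalHits-0 w) ⟩
        n + 0                          ≡⟨ +-identityʳ n ⟩
        n                              ∎))))
      where open ≡-Reasoning

    parking-zero : ∀ {w} → All (_≤ n) w → suc (length w) ≡ n → ¬ Parking (zero ∷ w)
    parking-zero w≤n eq p with parking⇒no-zeros (z≤n ∷ w≤n) eq p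
    ... | ()

    private
      positive⇒no-zeros : ∀ {w} → All (1 ≤_) w → totalHits w 1 ≡ 0
      positive⇒no-zeros []                   = refl
      positive⇒no-zeros {suc x ∷ w} (_ ∷ ps) = positive⇒no-zeros ps

      no-zeros⇒positive : ∀ w → totalHits w 1 ≡ 0 → All (1 ≤_) w
      no-zeros⇒positive []          _  = []
      no-zeros⇒positive (suc x ∷ w) eq = s≤s z≤n ∷ no-zeros⇒positive w eq

    isParkingFunction⇒parking : ∀ {π : Vec ℕ n} → IsParkingFunction π → Parking (toList π)
    isParkingFunction⇒parking {π} (isParkingFunction p b) s s<N =
      subst (λ z → z + s ≤ totalHits (toList π) (suc s))
        (sym (positive⇒no-zeros (VecAllₚ.toList⁺ p))) (bound s<N)
      where
      bound : ∀ {s} → s < suc n → s ≤ totalHits (toList π) (suc s)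
      bound {zero}  _         = z≤n
      bound {suc i} (s≤s i<n) =
        ≤-trans (sorted-bounded⇒count b i<n) (≤-reflexive (sym (totalHits-count (toList π) i<n)))

    parking⇒isParkingFunction : ∀ {π : Vec ℕ n} → All (_≤ n) (toList π) →
      Parking (toList π) → IsParkingFunction π
    parking⇒isParkingFunction {π} π≤n p = isParkingFunction
      (VecAllₚ.toList⁻ (no-zeros⇒positive (toList π) no-zeros))
      (subst (λ m → Pointwise _≤_ (sort (toList π)) (applyUpTo suc m)) (length-toList π)
        (count⇒sorted-bounded λ {i} i<m → let i<n = subst (i <_) (length-toList π) i<m in
          ≤-trans (subst (λ z → z + suc i ≤ totalHits (toList π) (2 + i)) no-zeros (p (suc i) (s≤s i<n)))
            (≤-reflexive (totalHits-count (toList π) i<n))))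
      where no-zeros = parking⇒no-zeros π≤n (length-toList π) p

    module _ {w : List ℕ} (w≤n : All (_≤ n) w) (∣w∣≡n : length w ≡ n) where

      -- `Parking` compares the hits after 1 and after s + 1 letters, hence the offset `suc`. The
      -- increment over a period is the length of w, which is n.
      open CycleLemma n (totalHits w ∘ suc) (λ u →
        trans (cong (totalHits w) (sym (+-suc (suc n) u)))
          (trans (totalHits-period w≤n (suc u)) (cong (_+ totalHits w (suc u)) ∣w∣≡n)))

      private
        hits-shift : ∀ t s → totalHits w (suc (t + s)) ≡ totalHits w t + totalHits (rotateⁿ t w) (suc s)
        hits-shift t s = trans (cong (totalHits w) (sym (+-suc t s))) (totalHits-rotateⁿ t w (suc s))

        hits-start : ∀ t s → totalHits w (suc t) + s ≡ totalHits w t + (totalHits (rotateⁿ t w) 1 + s)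
        hits-start t s = trans (cong (_+ s) (trans (cong (totalHits w) (+-comm 1 t)) (totalHits-rotateⁿ t w 1)))
          (+-assoc (totalHits w t) _ s)

        -- The hits up to time t occur on both sides of `Good t`; what is left after cancelling them
        -- is counted from the rotated word.
        good⇒parking : ∀ t → Good t → Parking (rotateⁿ t w)
        good⇒parking t good s s<N = +-cancelˡ-≤ (totalHits w t) _ _
          (subst₂ _≤_ (hits-start t s) (hits-shift t s) (good s<N))

        parking⇒good : ∀ t → Parking (rotateⁿ t w) → Good t
        parking⇒good t p {s} s<N =
          subst₂ _≤_ (sym (hits-start t s)) (sym (hits-shift t s)) (+-monoʳ-≤ (totalHits w t) (p s s<N))

      exists-parking-rotation : ∃ λ t → t ≤ n × Parking (rotateⁿ t w)
      exists-parking-rotation with exists-good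
      ... | t , t≤n , good = t , t≤n , good⇒parking t good

      parking-rotation-unique : ∀ {t u} → t ≤ n → u ≤ n →
        Parking (rotateⁿ t w) → Parking (rotateⁿ u w) → t ≡ u
      parking-rotation-unique t≤n u≤n p q = good-unique t≤n u≤n (parking⇒good _ p) (parking⇒good _ q)

    map-rotate-upTo : map rotate (upTo (suc n)) ↭ upTo (suc n)
    map-rotate-upTo = ↭-trans (↭-reflexive (cong (n ∷_) (map-applyUpTo suc rotate n)))
      (↭-trans (∷↭∷ʳ n (upTo n)) (↭-reflexive (upTo-∷ʳ n)))

-- Sums over words and over sublists

module Sums {c ℓ} (M : CommutativeMonoid c ℓ) where

  open import Data.List.Relation.Binary.Permutation.Propositional using (refl; prep; swap; trans)
  open CommutativeMonoid M
    renaming (_∙_ to _+_; ε to 0#; ∙-cong to +-cong; ∙-congˡ to +-congˡ; ∙-congʳ to +-congʳ;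
              identityˡ to +-identityˡ; identityʳ to +-identityʳ; assoc to +-assoc;
              trans to ≈-trans; sym to ≈-sym; refl to ≈-refl)
  open Algebra.Properties.CommutativeMonoid.Mult M
  open Algebra.Properties.CommutativeSemigroup commutativeSemigroup using (interchange; x∙yz≈y∙xz)
  open import Relation.Binary.Reasoning.Setoid setoid

  ∑ : ∀ {a} {A : Set a} → List A → (A → Carrier) → Carrier
  ∑ xs f = foldr (λ x s → f x + s) 0# xs

  ⟦_⟧ : ∀ {p} {P : Set p} → Dec P → Carrier → Carrier
  ⟦ P? ⟧ y = if does P? then y else 0#

  ⟦⟧-true : ∀ {p} {P : Set p} (P? : Dec P) → P → ∀ y → ⟦ P? ⟧ y ≈ y
  ⟦⟧-true (yes _) p y = ≈-refl
  ⟦⟧-true (no ¬p) p y = contradiction p ¬p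

  ⟦⟧-false : ∀ {p} {P : Set p} (P? : Dec P) → ¬ P → ∀ y → ⟦ P? ⟧ y ≈ 0#
  ⟦⟧-false (yes p) ¬p y = contradiction p ¬p
  ⟦⟧-false (no _)  ¬p y = ≈-refl

  ⟦⟧-congˡ : ∀ {p r} {P : Set p} {R : Set r} (P? : Dec P) (R? : Dec R) → (P → R) → (R → P) →
    ∀ y → ⟦ P? ⟧ y ≈ ⟦ R? ⟧ y
  ⟦⟧-congˡ (yes p) R? f g y = ≈-sym (⟦⟧-true R? (f p) y)
  ⟦⟧-congˡ (no ¬p) R? f g y = ≈-sym (⟦⟧-false R? (¬p ∘ g) y)

  ⟦⟧-congʳ : ∀ {p} {P : Set p} (P? : Dec P) {y z} → y ≈ z → ⟦ P? ⟧ y ≈ ⟦ P? ⟧ z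
  ⟦⟧-congʳ (yes _) y≈z = y≈z
  ⟦⟧-congʳ (no _)  _   = ≈-refl

  ×-zeroʳ : ∀ m → m × 0# ≈ 0#
  ×-zeroʳ zero    = ≈-refl
  ×-zeroʳ (suc m) = ≈-trans (+-identityˡ _) (×-zeroʳ m)

  module _ {a} {A : Set a} where

    ∑-cong-∈ : ∀ (xs : List A) {f g} → (∀ {x} → x ∈ xs → f x ≈ g x) → ∑ xs f ≈ ∑ xs g
    ∑-cong-∈ []       f≈g = ≈-refl
    ∑-cong-∈ (x ∷ xs) f≈g = +-cong (f≈g (here ≡.refl)) (∑-cong-∈ xs (f≈g ∘ there))

    ∑-cong : ∀ (xs : List A) {f g} → (∀ x → f x ≈ g x) → ∑ xs f ≈ ∑ xs g
    ∑-cong xs f≈g = ∑-cong-∈ xs λ {x} _ → f≈g x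

    ∑-zero : ∀ (xs : List A) → ∑ xs (λ _ → 0#) ≈ 0#
    ∑-zero []       = ≈-refl
    ∑-zero (x ∷ xs) = ≈-trans (+-identityˡ _) (∑-zero xs)

    ∑-+ : ∀ (xs : List A) f g → ∑ xs (λ x → f x + g x) ≈ ∑ xs f + ∑ xs g
    ∑-+ []       f g = ≈-sym (+-identityˡ 0#)
    ∑-+ (x ∷ xs) f g = ≈-trans (+-congˡ (∑-+ xs f g)) (interchange _ _ _ _)

    ∑-const : ∀ (xs : List A) y → ∑ xs (λ _ → y) ≈ length xs × y
    ∑-const []       y = ≈-refl
    ∑-const (x ∷ xs) y = +-congˡ (∑-const xs y)

    ∑-++ : ∀ (xs ys : List A) f → ∑ (xs ++ ys) f ≈ ∑ xs f + ∑ ys f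
    ∑-++ []       ys f = ≈-sym (+-identityˡ _)
    ∑-++ (x ∷ xs) ys f = ≈-trans (+-congˡ (∑-++ xs ys f)) (≈-sym (+-assoc _ _ _))

    ∑-map : ∀ {b} {B : Set b} (g : B → A) xs f → ∑ (map g xs) f ≈ ∑ xs (f ∘ g)
    ∑-map g []       f = ≈-refl
    ∑-map g (x ∷ xs) f = +-congˡ (∑-map g xs f)

    ∑-↭ : ∀ {xs ys : List A} f → xs ↭ ys → ∑ xs f ≈ ∑ ys f
    ∑-↭ f refl          = ≈-refl
    ∑-↭ f (prep x p)    = +-congˡ (∑-↭ f p)
    ∑-↭ f (swap x y p)  = ≈-trans (x∙yz≈y∙xz _ _ _) (+-congˡ (+-congˡ (∑-↭ f p)))
    ∑-↭ f (trans p₁ p₂) = ≈-trans (∑-↭ f p₁) (∑-↭ f p₂)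

    ∑-single : ∀ {xs : List A} {x} f → Unique xs → x ∈ xs →
      (∀ {y} → y ∈ xs → y ≢ x → f y ≈ 0#) → ∑ xs f ≈ f x
    ∑-single {xs = x ∷ xs} f (x∉xs ∷ u) (here ≡.refl) h = begin
      f x + ∑ xs f           ≈⟨ +-congˡ (∑-cong-∈ xs λ y∈xs → h (there y∈xs) (All.lookup x∉xs y∈xs ∘ ≡.sym)) ⟩
      f x + ∑ xs (λ _ → 0#)  ≈⟨ +-congˡ (∑-zero xs) ⟩
      f x + 0#               ≈⟨ +-identityʳ (f x) ⟩
      f x                    ∎
    ∑-single {xs = y ∷ xs} {x} f (y∉xs ∷ u) (there x∈xs) h = begin
      f y + ∑ xs f  ≈⟨ +-cong (h (here ≡.refl) (All.lookup y∉xs x∈xs)) (∑-single f u x∈xs (h ∘ there)) ⟩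
      0# + f x      ≈⟨ +-identityˡ (f x) ⟩
      f x           ∎

    ∑-filter : ∀ {p} {P : Pred A p} (P? : Decidable P) xs f →
      ∑ (filter P? xs) f ≈ ∑ xs (λ x → ⟦ P? x ⟧ (f x))
    ∑-filter P? []       f = ≈-refl
    ∑-filter P? (x ∷ xs) f with P? x
    ... | yes _ = +-congˡ (∑-filter P? xs f)
    ... | no  _ = ≈-trans (∑-filter P? xs f) (≈-sym (+-identityˡ _))

  ∑-cartesianProductWith : ∀ {a b d} {A : Set a} {B : Set b} {D : Set d} (_⊛_ : A → B → D) xs ys f →
    ∑ (cartesianProductWith _⊛_ xs ys) f ≈ ∑ xs (λ x → ∑ ys (λ y → f (x ⊛ y)))
  ∑-cartesianProductWith _⊛_ []       ys f = ≈-refl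
  ∑-cartesianProductWith _⊛_ (x ∷ xs) ys f = ≈-trans (∑-++ (map (x ⊛_) ys) _ f)
    (+-cong (∑-map (x ⊛_) ys f) (∑-cartesianProductWith _⊛_ xs ys f))

  ∑-swap : ∀ {a b} {A : Set a} {B : Set b} xs ys (f : A → B → Carrier) →
    ∑ xs (λ x → ∑ ys (f x)) ≈ ∑ ys (λ y → ∑ xs (λ x → f x y))
  ∑-swap []       ys f = ≈-sym (∑-zero ys)
  ∑-swap (x ∷ xs) ys f = ≈-trans (+-congˡ (∑-swap xs ys f)) (≈-sym (∑-+ ys (f x) _))

  ∑-homo : ∀ {T : Carrier → Carrier} → IsMonoidHomomorphism rawMonoid rawMonoid T →
    ∀ {a} {A : Set a} (xs : List A) f → T (∑ xs f) ≈ ∑ xs (T ∘ f)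
  ∑-homo T-homo []       f = IsMonoidHomomorphism.ε-homo T-homo
  ∑-homo T-homo (x ∷ xs) f = ≈-trans (IsMonoidHomomorphism.homo T-homo _ _) (+-congˡ (∑-homo T-homo xs f))

  module WordSums {a} {A : Set a} (L : List A) where

    wordSum : ℕ → (List A → Carrier) → Carrier
    wordSum zero    f = f []
    wordSum (suc k) f = ∑ L (λ a → wordSum k (f ∘ (a ∷_)))

    wordSum-cong-∈ : ∀ k {f g} → (∀ {w} → All (_∈ L) w → length w ≡ k → f w ≈ g w) →
      wordSum k f ≈ wordSum k g
    wordSum-cong-∈ zero    f≈g = f≈g [] ≡.refl
    wordSum-cong-∈ (suc k) f≈g = ∑-cong-∈ L λ a∈L →
      wordSum-cong-∈ k λ w∈L ∣w∣≡k → f≈g (a∈L ∷ w∈L) (cong suc ∣w∣≡k)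

    wordSum-cong : ∀ k {f g} → (∀ w → f w ≈ g w) → wordSum k f ≈ wordSum k g
    wordSum-cong k f≈g = wordSum-cong-∈ k λ {w} _ _ → f≈g w

    wordSum-map : ∀ {s} → map s L ↭ L → ∀ k f → wordSum k f ≈ wordSum k (f ∘ map s)
    wordSum-map     sL↭L zero    f = ≈-refl
    wordSum-map {s} sL↭L (suc k) f = begin
      ∑ L (λ a → wordSum k (f ∘ (a ∷_)))                ≈⟨ ∑-↭ _ (↭-sym sL↭L) ⟩
      ∑ (map s L) (λ a → wordSum k (f ∘ (a ∷_)))        ≈⟨ ∑-map s L _ ⟩
      ∑ L (λ a → wordSum k (f ∘ (s a ∷_)))              ≈⟨ ∑-cong L (λ a → wordSum-map sL↭L k (f ∘ (s a ∷_))) ⟩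
      ∑ L (λ a → wordSum k (λ w → f (s a ∷ map s w)))   ∎

    wordSum-const : ∀ k y → wordSum k (λ _ → y) ≈ (length L ℕ.^ k) × y
    wordSum-const zero    y = ≈-sym (×-homo-1 y)
    wordSum-const (suc k) y = begin
      ∑ L (λ _ → wordSum k (λ _ → y))      ≈⟨ ∑-const L _ ⟩
      length L × wordSum k (λ _ → y)       ≈⟨ ×-congʳ (length L) (wordSum-const k y) ⟩
      length L × (length L ℕ.^ k) × y      ≈⟨ ×-assocˡ y (length L) _ ⟩
      (length L ℕ.^ suc k) × y             ∎

    wordSum-∑ : ∀ {b} {B : Set b} (ts : List B) k (f : B → List A → Carrier) →
      ∑ ts (λ t → wordSum k (f t)) ≈ wordSum k (λ w → ∑ ts (λ t → f t w))
    wordSum-∑ ts zero    f = ≈-refl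
    wordSum-∑ ts (suc k) f = ≈-trans (∑-swap ts L _)
      (∑-cong L λ a → wordSum-∑ ts k (λ t → f t ∘ (a ∷_)))

    -- Marked positions and sublists

    module Marked {X : Carrier → Carrier} (X-homo : IsMonoidHomomorphism rawMonoid rawMonoid X) where

      open IsMonoidHomomorphism X-homo
        renaming (homo to X-+; ε-homo to X-0; ⟦⟧-cong to X-cong)

      -- The sum over words w of length |is| of (1 + X)^m f w, with m the
      -- number of positions at which w agrees with is.
      markedSum : List A → (List A → Carrier) → Carrier
      markedSum []       f = f []
      markedSum (i ∷ is) f = ∑ L (λ a → markedSum is (f ∘ (a ∷_))) + X (markedSum is (f ∘ (i ∷_)))

      -- The sum over sublists S of is of X^|S| f S k, with k = |is| − |S|.
      sublistSum : List A → (List A → ℕ → Carrier) → Carrier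
      sublistSum []       f = f [] 0
      sublistSum (i ∷ is) f =
        sublistSum is (λ S k → f S (suc k)) + X (sublistSum is (λ S k → f (i ∷ S) k))

      sublistSum-cong-∈ : ∀ {is f g} → All (_∈ L) is →
        (∀ {S k} → All (_∈ L) S → length S ℕ.+ k ≡ length is → f S k ≈ g S k) →
        sublistSum is f ≈ sublistSum is g
      sublistSum-cong-∈ []              f≈g = f≈g [] ≡.refl
      sublistSum-cong-∈ (i∈L ∷ is∈L) f≈g = +-cong
        (sublistSum-cong-∈ is∈L λ {S} S∈L eq → f≈g S∈L (≡.trans (ℕ.+-suc (length S) _) (cong suc eq)))
        (X-cong (sublistSum-cong-∈ is∈L λ S∈L eq → f≈g (i∈L ∷ S∈L) (cong suc eq)))

      sublistSum-cong : ∀ is {f g} → (∀ S k → f S k ≈ g S k) → sublistSum is f ≈ sublistSum is g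
      sublistSum-cong []       f≈g = f≈g [] 0
      sublistSum-cong (i ∷ is) f≈g = +-cong
        (sublistSum-cong is λ S k → f≈g S (suc k))
        (X-cong (sublistSum-cong is λ S → f≈g (i ∷ S)))

      sublistSum-zero : ∀ is → sublistSum is (λ _ _ → 0#) ≈ 0#
      sublistSum-zero []       = ≈-refl
      sublistSum-zero (i ∷ is) = ≈-trans
        (+-cong (sublistSum-zero is) (≈-trans (X-cong (sublistSum-zero is)) X-0)) (+-identityˡ 0#)

      sublistSum-+ : ∀ is f g →
        sublistSum is (λ S k → f S k + g S k) ≈ sublistSum is f + sublistSum is g
      sublistSum-+ []       f g = ≈-refl
      sublistSum-+ (i ∷ is) f g = ≈-trans
        (+-cong (sublistSum-+ is _ _) (≈-trans (X-cong (sublistSum-+ is _ _)) (X-+ _ _)))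
        (interchange _ _ _ _)

      sublistSum-∑ : ∀ {b} {B : Set b} (ts : List B) is (f : B → List A → ℕ → Carrier) →
        ∑ ts (λ t → sublistSum is (f t)) ≈ sublistSum is (λ S k → ∑ ts (λ t → f t S k))
      sublistSum-∑ []       is f = ≈-sym (sublistSum-zero is)
      sublistSum-∑ (t ∷ ts) is f = ≈-trans (+-congˡ (sublistSum-∑ ts is f)) (≈-sym (sublistSum-+ is (f t) _))

      sublistSum-× : ∀ m is f → m × sublistSum is f ≈ sublistSum is (λ S k → m × f S k)
      sublistSum-× zero    is f = ≈-sym (sublistSum-zero is)
      sublistSum-× (suc m) is f = ≈-trans (+-congˡ (sublistSum-× m is f)) (≈-sym (sublistSum-+ is f _))

      sublistSum-map : ∀ s is f → sublistSum (map s is) f ≈ sublistSum is (λ S k → f (map s S) k)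
      sublistSum-map s []       f = ≈-refl
      sublistSum-map s (i ∷ is) f = +-cong (sublistSum-map s is _) (X-cong (sublistSum-map s is _))

      Symmetric : (List A → Carrier) → Set _
      Symmetric f = ∀ {v w} → v ↭ w → f v ≈ f w

      -- Sublists inherit the order of the list, so a permutation of the list permutes each S;
      -- symmetry of `f` hides this. For a swap, the four choices from i and j are regrouped: the
      -- two singletons trade places, and the pair is reordered.
      sublistSum-↭ : ∀ {is js} f → (∀ k → Symmetric (λ S → f S k)) → is ↭ js →
        sublistSum is f ≈ sublistSum js f
      sublistSum-↭ f f-sym refl = ≈-refl
      sublistSum-↭ f f-sym (prep i p) = +-cong
        (sublistSum-↭ _ (f-sym ∘ suc) p)
        (X-cong (sublistSum-↭ _ (λ k q → f-sym k (prep i q)) p))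
      sublistSum-↭ f f-sym (trans p₁ p₂) = ≈-trans (sublistSum-↭ f f-sym p₁) (sublistSum-↭ f f-sym p₂)
      sublistSum-↭ f f-sym (swap {xs = is} {ys = js} i j p) = begin
        (none is + X (one j is)) + X (one i is + X (two i j is))     ≈⟨ +-congˡ (X-+ _ _) ⟩
        (none is + X (one j is)) + (X (one i is) + X (X (two i j is))) ≈⟨ interchange _ _ _ _ ⟩
        (none is + X (one i is)) + (X (one j is) + X (X (two i j is)))
          ≈⟨ +-cong (+-cong (sublistSum-↭ _ (λ k → f-sym (2 ℕ.+ k)) p) (X-cong (one-↭ i)))
                    (+-cong (X-cong (one-↭ j)) (X-cong (X-cong two-↭))) ⟩
        (none js + X (one i js)) + (X (one j js) + X (X (two j i js))) ≈⟨ +-congˡ (X-+ _ _) ⟨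
        (none js + X (one i js)) + X (one j js + X (two j i js))     ∎
        where
        none : List A → Carrier
        none is = sublistSum is (λ S k → f S (2 ℕ.+ k))
        one : A → List A → Carrier
        one i is = sublistSum is (λ S k → f (i ∷ S) (suc k))
        two : A → A → List A → Carrier
        two i j is = sublistSum is (λ S k → f (i ∷ j ∷ S) k)
        one-↭ : ∀ i → one i is ≈ one i js
        one-↭ i = sublistSum-↭ _ (λ k q → f-sym (suc k) (prep i q)) p
        two-↭ : two i j is ≈ two j i js
        two-↭ = ≈-trans (sublistSum-cong is λ S k → f-sym k (swap i j refl))
          (sublistSum-↭ _ (λ k q → f-sym k (prep j (prep i q))) p)

      -- At each position the letter is either marked, and joins S, or free. A free letter a arises
      -- in front of S, and symmetry moves it behind S, where it becomes the first letter of a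
      -- longer free word.
      markedSum≈sublistSum : ∀ is {f} → Symmetric f →
        markedSum is f ≈ sublistSum is (λ S k → wordSum k (λ w → f (S ++ w)))
      markedSum≈sublistSum []       f-sym = ≈-refl
      markedSum≈sublistSum (i ∷ is) {f} f-sym = +-cong
        (begin
          ∑ L (λ a → markedSum is (f ∘ (a ∷_)))
            ≈⟨ ∑-cong L (λ a → markedSum≈sublistSum is (f-sym ∘ prep a)) ⟩
          ∑ L (λ a → sublistSum is (λ S k → wordSum k (λ w → f (a ∷ S ++ w))))
            ≈⟨ sublistSum-∑ L is _ ⟩
          sublistSum is (λ S k → ∑ L (λ a → wordSum k (λ w → f (a ∷ S ++ w))))
            ≈⟨ sublistSum-cong is (λ S k → ∑-cong L λ a → wordSum-cong k λ w → f-sym (↭-sym (shift a S w))) ⟩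
          sublistSum is (λ S k → wordSum (suc k) (λ w → f (S ++ w)))
            ∎)
        (X-cong (markedSum≈sublistSum is (f-sym ∘ prep i)))

      -- As S ranges over the sublists of all of L, but words have length
      -- |L| − 1, only k − 1 letters remain free, and S = L contributes nothing.
      completions : (List A → Carrier) → List A → ℕ → Carrier
      completions f S zero    = 0#
      completions f S (suc k) = wordSum k (λ w → f (S ++ w))

      completions-sym : ∀ {f} → Symmetric f → ∀ k → Symmetric (λ S → completions f S k)
      completions-sym f-sym zero    p = ≈-refl
      completions-sym f-sym (suc k) p = wordSum-cong k λ w → f-sym (++⁺ʳ w p)

      module _ {s : A → A} (sL↭L : map s L ↭ L) where

        -- Since `s` permutes the alphabet, applying it reindexes both the sublists S and the free
        -- words w.
        sublistSum-completions-map : ∀ {f} → Symmetric f →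
          sublistSum L (completions f) ≈ sublistSum L (completions (f ∘ map s))
        sublistSum-completions-map {f} f-sym = begin
          sublistSum L (completions f)
            ≈⟨ sublistSum-↭ _ (completions-sym f-sym) (↭-sym sL↭L) ⟩
          sublistSum (map s L) (completions f)
            ≈⟨ sublistSum-map s L _ ⟩
          sublistSum L (λ S k → completions f (map s S) k)
            ≈⟨ sublistSum-cong L pointwise ⟩
          sublistSum L (completions (f ∘ map s))
            ∎
          where
          pointwise : ∀ S k → completions f (map s S) k ≈ completions (f ∘ map s) S k
          pointwise S zero    = ≈-refl
          pointwise S (suc k) = ≈-trans (wordSum-map sL↭L k _)
            (wordSum-cong k λ w → reflexive (cong f (≡.sym (map-++ s S w))))

        sublistSum-completions-mapⁿ : ∀ t {f} → Symmetric f →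
          sublistSum L (completions f) ≈ sublistSum L (completions (f ∘ mapⁿ s t))
        sublistSum-completions-mapⁿ zero    f-sym = ≈-refl
        sublistSum-completions-mapⁿ (suc t) f-sym = ≈-trans (sublistSum-completions-mapⁿ t f-sym)
          (sublistSum-completions-map (f-sym ∘ mapⁿ-↭ s t))

      -- The binomial theorem for the operator m + X: each element of the list is left out, with
      -- factor m, or selected, with factor X.
      sublistSum-powers : ∀ m is y →
        sublistSum is (λ S k → (m ℕ.^ k) × y) ≈ fold y (λ z → m × z + X z) (length is)
      sublistSum-powers m []       y = ×-homo-1 y
      sublistSum-powers m (i ∷ is) y = +-cong
        (begin
          sublistSum is (λ S k → (m ℕ.* m ℕ.^ k) × y) ≈⟨ sublistSum-cong is (λ S k → ×-assocˡ y m (m ℕ.^ k)) ⟨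
          sublistSum is (λ S k → m × (m ℕ.^ k) × y)   ≈⟨ sublistSum-× m is _ ⟨
          m × sublistSum is (λ S k → (m ℕ.^ k) × y)   ≈⟨ ×-congʳ m (sublistSum-powers m is y) ⟩
          m × fold y (λ z → m × z + X z) (length is)  ∎)
        (X-cong (sublistSum-powers m is y))

      -- The number of unselected elements is 0 only when S is the whole list, so this weight
      -- isolates the top power of X.
      ifZero : Carrier → ℕ → Carrier
      ifZero y zero    = y
      ifZero y (suc k) = 0#

      sublistSum-ifZero : ∀ is y → sublistSum is (λ S → ifZero y) ≈ fold y X (length is)
      sublistSum-ifZero []       y = ≈-refl
      sublistSum-ifZero (i ∷ is) y =
        ≈-trans (+-cong (sublistSum-zero is) (X-cong (sublistSum-ifZero is y))) (+-identityˡ _)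

  -- Averaging over the rotations

  module _ {X : Carrier → Carrier} (X-homo : IsMonoidHomomorphism rawMonoid rawMonoid X)
           {a} {A : Set a} (z : A) (is : List A) where

    private
      L = z ∷ is
      N = length L
      n = length is

    open WordSums L
    open Marked X-homo
    open IsMonoidHomomorphism X-homo renaming (ε-homo to X-0; ⟦⟧-cong to X-cong)

    module _ {s : A → A} (sL↭L : map s L ↭ L) {f : List A → Carrier} (f-sym : Symmetric f) {y : Carrier}
             (f-z : ∀ {w} → All (_∈ L) w → suc (length w) ≡ n → f (z ∷ w) ≈ 0#)
             (f-orbit : ∀ {w} → All (_∈ L) w → length w ≡ n → ∑ (upTo N) (λ t → f (mapⁿ s t w)) ≈ y) where

      private
        powers : List A → ℕ → Carrier
        powers S zero    = 0#
        powers S (suc k) = (N ℕ.^ k) × y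

        -- If S avoids z, then z itself is the one extra unselected element, which the index shift
        -- in `completions` cancels. If S contains z, the contribution vanishes by `f-z`.
        marked≈completions : markedSum is f ≈ sublistSum L (completions f)
        marked≈completions = begin
          markedSum is f                               ≈⟨ markedSum≈sublistSum is f-sym ⟩
          without                                      ≈⟨ +-identityʳ without ⟨
          without + 0#                                 ≈⟨ +-congˡ (≈-trans (X-cong (sublistSum-zero is)) X-0) ⟨
          without + X (sublistSum is (λ _ _ → 0#))     ≈⟨ +-congˡ (X-cong (sublistSum-cong-∈ (All.tabulate there) vanish)) ⟨
          sublistSum L (completions f)                 ∎
          where
          without = sublistSum is (λ S k → wordSum k (λ w → f (S ++ w)))
          vanish : ∀ {S k} → All (_∈ L) S → length S ℕ.+ k ≡ n → completions f (z ∷ S) k ≈ 0#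
          vanish {S} {zero}  S∈L eq = ≈-refl
          vanish {S} {suc k} S∈L eq = begin
            wordSum k (λ w → f (z ∷ S ++ w))  ≈⟨ wordSum-cong-∈ k (λ {w} w∈L ∣w∣≡k →
                                                   f-z (Allₚ.++⁺ S∈L w∈L) (length-eq w ∣w∣≡k)) ⟩
            wordSum k (λ _ → 0#)              ≈⟨ wordSum-const k 0# ⟩
            (N ℕ.^ k) × 0#                    ≈⟨ ×-zeroʳ (N ℕ.^ k) ⟩
            0#                                ∎
            where
            length-eq : ∀ w → length w ≡ k → suc (length (S ++ w)) ≡ n
            length-eq w ≡.refl = ≡.trans (cong suc (length-++ S)) (≡.trans (≡.sym (ℕ.+-suc (length S) _)) eq)

        -- The N equal copies are replaced by the N rotated forms of the sum. For fixed S and w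
        -- these add up to y, and there are N^k words w.
        average : N × sublistSum L (completions f) ≈ sublistSum L powers
        average = begin
          N × sublistSum L (completions f)
            ≡⟨ cong (_× sublistSum L (completions f)) (length-upTo N) ⟨
          length (upTo N) × sublistSum L (completions f)
            ≈⟨ ∑-const (upTo N) _ ⟨
          ∑ (upTo N) (λ _ → sublistSum L (completions f))
            ≈⟨ ∑-cong (upTo N) (λ t → sublistSum-completions-mapⁿ sL↭L t f-sym) ⟩
          ∑ (upTo N) (λ t → sublistSum L (completions (f ∘ mapⁿ s t)))
            ≈⟨ sublistSum-∑ (upTo N) L (λ t → completions (f ∘ mapⁿ s t)) ⟩
          sublistSum L (λ S k → ∑ (upTo N) (λ t → completions (f ∘ mapⁿ s t) S k))
            ≈⟨ sublistSum-cong-∈ (All.tabulate id) pointwise ⟩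
          sublistSum L powers
            ∎
          where
          pointwise : ∀ {S k} → All (_∈ L) S → length S ℕ.+ k ≡ N →
            ∑ (upTo N) (λ t → completions (f ∘ mapⁿ s t) S k) ≈ powers S k
          pointwise {S} {zero}  S∈L eq = ∑-zero (upTo N)
          pointwise {S} {suc k} S∈L eq = begin
            ∑ (upTo N) (λ t → wordSum k (λ w → f (mapⁿ s t (S ++ w)))) ≈⟨ wordSum-∑ (upTo N) k _ ⟩
            wordSum k (λ w → ∑ (upTo N) (λ t → f (mapⁿ s t (S ++ w))))
              ≈⟨ wordSum-cong-∈ k (λ {w} w∈L ∣w∣≡k → f-orbit (Allₚ.++⁺ S∈L w∈L) (length-eq w ∣w∣≡k)) ⟩
            wordSum k (λ _ → y)                                        ≈⟨ wordSum-const k y ⟩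
            (N ℕ.^ k) × y                                              ∎
            where
            length-eq : ∀ w → length w ≡ k → length (S ++ w) ≡ n
            length-eq w ≡.refl = ≡.trans (length-++ S)
              (ℕ.suc-injective (≡.trans (≡.sym (ℕ.+-suc (length S) _)) eq))

      -- The second factor N turns N^k into N^(k+1), the binomial weight of every S other than L.
      -- The term for S = L is absent on the left, and the summand `fold y X N` supplies it.
      markedSum-orbit : N × (N × markedSum is f) + fold y X N ≈ fold y (λ x → N × x + X x) N
      markedSum-orbit = begin
        N × (N × markedSum is f) + fold y X N
          ≈⟨ +-cong (×-congʳ N (≈-trans (×-congʳ N marked≈completions) average)) (≈-sym (sublistSum-ifZero L y)) ⟩
        N × sublistSum L powers + sublistSum L (λ S → ifZero y)
          ≈⟨ +-congʳ (sublistSum-× N L powers) ⟩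
        sublistSum L (λ S k → N × powers S k) + sublistSum L (λ S → ifZero y)
          ≈⟨ sublistSum-+ L (λ S k → N × powers S k) (λ S → ifZero y) ⟨
        sublistSum L (λ S k → N × powers S k + ifZero y k)
          ≈⟨ sublistSum-cong L pointwise ⟩
        sublistSum L (λ S k → (N ℕ.^ k) × y)
          ≈⟨ sublistSum-powers N L y ⟩
        fold y (λ x → N × x + X x) N
          ∎
        where
        pointwise : ∀ S k → N × powers S k + ifZero y k ≈ (N ℕ.^ k) × y
        pointwise S zero    = begin
          N × 0# + y  ≈⟨ +-congʳ (×-zeroʳ N) ⟩
          0# + y      ≈⟨ +-identityˡ y ⟩
          y           ≈⟨ ×-homo-1 y ⟨
          1 × y       ∎
        pointwise S (suc k) = ≈-trans (+-identityʳ _) (×-assocˡ y N (N ℕ.^ k))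

-- Fixed points as marked sums

∈-words⁻ : ∀ {xs} k {π : Vec ℕ k} → π ∈ words xs k → All (_∈ xs) (toList π)
∈-words⁻      zero    {[]} _ = []
∈-words⁻ {xs} (suc k) π∈ with ∈-cartesianProductWith⁻ _∷_ xs (words xs k) π∈
... | _ , _ , x∈xs , π∈′ , ≡.refl = x∈xs ∷ ∈-words⁻ k π∈′

agreements : ∀ {k} → (ℕ → ℕ) → Vec ℕ k → ℕ
agreements u []      = 0
agreements u (a ∷ π) = (if does (a ℕ.≟ u 0) then suc else id) (agreements (u ∘ suc) π)

-- Exposes the first letter for recursion; the target `suc` is generalised to `u` because the tail
-- is compared with `u ∘ suc`.
fix≡agreements : ∀ {n} (π : Vec ℕ n) → fix π ≡ agreements suc π
fix≡agreements = count-lookup suc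
  where
  count-tabulate-suc : ∀ {p n} {P : Pred (Fin (suc n)) p} (P? : Decidable P) {m} (g : Fin m → Fin n) →
    count P? (tabulate (Fin.suc ∘ g)) ≡ count (P? ∘ Fin.suc) (tabulate g)
  count-tabulate-suc P? {zero}  g = ≡.refl
  count-tabulate-suc P? {suc m} g =
    cong (if does (P? (Fin.suc (g Fin.zero))) then suc else id) (count-tabulate-suc P? (g ∘ Fin.suc))

  count-lookup : ∀ {k} (u : ℕ → ℕ) (π : Vec ℕ k) →
    count (λ i → lookup π i ℕ.≟ u (toℕ i)) (allFin k) ≡ agreements u π
  count-lookup u []      = ≡.refl
  count-lookup u (a ∷ π) = cong (if does (a ℕ.≟ u 0) then suc else id)
    (≡.trans (count-tabulate-suc (λ i → lookup (a ∷ π) i ℕ.≟ u (toℕ i)) id) (count-lookup (u ∘ suc) π))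

module WordsSum {c ℓ} (M : CommutativeMonoid c ℓ) where

  open CommutativeMonoid M
    renaming (_∙_ to _+_; ε to 0#; ∙-cong to +-cong; ∙-congˡ to +-congˡ; ∙-congʳ to +-congʳ;
              identityˡ to +-identityˡ; identityʳ to +-identityʳ;
              trans to ≈-trans; sym to ≈-sym; refl to ≈-refl)
  open Sums M
  open import Algebra.Properties.CommutativeSemigroup commutativeSemigroup using (interchange)
  open import Relation.Binary.Reasoning.Setoid setoid

  -- Used to pass from the letters 1,...,n to 0,...,n, on which rotation acts: every added word
  -- contains z.
  words-∷ : ∀ z xs k {f : Vec ℕ k → Carrier} → (∀ {π} → z ∈ᵥ π → f π ≈ 0#) →
    ∑ (words xs k) f ≈ ∑ (words (z ∷ xs) k) f
  words-∷ z xs zero    f-z = ≈-refl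
  words-∷ z xs (suc k) {f} f-z = begin
    ∑ (words xs (suc k)) f
      ≈⟨ ∑-cartesianProductWith _∷_ xs (words xs k) f ⟩
    ∑ xs (λ a → ∑ (words xs k) (f ∘ (a ∷_)))
      ≈⟨ ∑-cong xs (λ a → words-∷ z xs k (f-z ∘ VecAny.there)) ⟩
    rest
      ≈⟨ +-identityˡ rest ⟨
    0# + rest
      ≈⟨ +-congʳ (∑-zero (words (z ∷ xs) k)) ⟨
    ∑ (words (z ∷ xs) k) (λ _ → 0#) + rest
      ≈⟨ +-congʳ (∑-cong (words (z ∷ xs) k) (λ π → f-z (VecAny.here ≡.refl))) ⟨
    ∑ (words (z ∷ xs) k) (f ∘ (z ∷_)) + rest
      ≈⟨ ∑-cartesianProductWith _∷_ (z ∷ xs) (words (z ∷ xs) k) f ⟨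
    ∑ (words (z ∷ xs) (suc k)) f
      ∎
    where rest = ∑ xs (λ a → ∑ (words (z ∷ xs) k) (f ∘ (a ∷_)))

  module _ {X : Carrier → Carrier} (X-homo : IsMonoidHomomorphism rawMonoid rawMonoid X) where

    open IsMonoidHomomorphism X-homo
      renaming (homo to X-+; ε-homo to X-0; ⟦⟧-cong to X-cong)

    1+X : Carrier → Carrier
    1+X y = y + X y

    1+X-homo : IsMonoidHomomorphism rawMonoid rawMonoid 1+X
    1+X-homo = record
      { isMagmaHomomorphism = record
        { isRelHomomorphism = record { cong = λ eq → +-cong eq (X-cong eq) }
        ; homo = λ x y → ≈-trans (+-congˡ (X-+ x y)) (interchange x y (X x) (X y))
        }
      ; ε-homo = ≈-trans (+-identityˡ _) X-0
      }

    fold-zero : ∀ m → fold 0# 1+X m ≈ 0#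
    fold-zero zero    = ≈-refl
    fold-zero (suc m) = ≈-trans (IsMonoidHomomorphism.⟦⟧-cong 1+X-homo (fold-zero m))
      (IsMonoidHomomorphism.ε-homo 1+X-homo)

    ⟦⟧-fold : ∀ {p} {P : Set p} (P? : Dec P) y m → ⟦ P? ⟧ (fold y 1+X m) ≈ fold (⟦ P? ⟧ y) 1+X m
    ⟦⟧-fold (yes _) y m = ≈-refl
    ⟦⟧-fold (no _)  y m = ≈-sym (fold-zero m)

    module _ {L : List ℕ} (L-unique : Unique L) where

      open WordSums L
      open Marked X-homo

      -- A first letter equal to `u 0` brings one more factor 1 + X, which additivity pulls out of
      -- the sum over tails; its 1 joins the unrestricted sum over letters. As L has no repetitions,
      -- the X part occurs exactly once.
      ∑-words≈markedSum : ∀ u k f → (∀ {i} → i ℕ.< k → u i ∈ L) →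
        ∑ (words L k) (λ π → fold (f (toList π)) 1+X (agreements u π)) ≈ markedSum (applyUpTo u k) f
      ∑-words≈markedSum u zero    f u∈L = +-identityʳ (f [])
      ∑-words≈markedSum u (suc k) f u∈L = begin
        ∑ (words L (suc k)) (λ π → fold (f (toList π)) 1+X (agreements u π))
          ≈⟨ ∑-cartesianProductWith _∷_ L (words L k) _ ⟩
        ∑ L (λ a → ∑ (words L k) (λ π → fold (f (a ∷ toList π)) 1+X (agreements u (a ∷ π))))
          ≈⟨ ∑-cong L (λ a → first a (a ℕ.≟ u 0)) ⟩
        ∑ L (λ a → rest a + ⟦ a ℕ.≟ u 0 ⟧ (X (rest a)))
          ≈⟨ ∑-+ L rest _ ⟩
        ∑ L rest + ∑ L (λ a → ⟦ a ℕ.≟ u 0 ⟧ (X (rest a)))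
          ≈⟨ +-congˡ (≈-trans (∑-single _ L-unique (u∈L ℕ.z<s) λ {a} _ a≢u0 → ⟦⟧-false (a ℕ.≟ u 0) a≢u0 (X (rest a)))
                             (⟦⟧-true (u 0 ℕ.≟ u 0) ≡.refl (X (rest (u 0))))) ⟩
        ∑ L rest + X (rest (u 0))
          ∎
        where
        rest : ℕ → Carrier
        rest a = markedSum (applyUpTo (u ∘ suc) k) (f ∘ (a ∷_))

        IH : ∀ a → ∑ (words L k) (λ π → fold (f (a ∷ toList π)) 1+X (agreements (u ∘ suc) π)) ≈ rest a
        IH a = ∑-words≈markedSum (u ∘ suc) k (f ∘ (a ∷_)) (u∈L ∘ ℕ.s≤s)

        first : ∀ a (d : Dec (a ≡ u 0)) →
          ∑ (words L k) (λ π → fold (f (a ∷ toList π)) 1+X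
            ((if does d then suc else id) (agreements (u ∘ suc) π))) ≈
          rest a + ⟦ d ⟧ (X (rest a))
        first a (yes _) = ≈-trans (≈-sym (∑-homo 1+X-homo (words L k) _))
          (IsMonoidHomomorphism.⟦⟧-cong 1+X-homo (IH a))
        first a (no _)  = ≈-trans (IH a) (≈-sym (+-identityʳ _))

open import Data.Integer.Base as ℤ using (+_)
open import Defs
open ≡ using (sym; trans; cong₂; module ≡-Reasoning)

-- Polynomials as a module over multiplication by linear polynomials

coeff-+ : ∀ p r k → coeff (p + r) k ≡ coeff p k ℚ.+ coeff r k
coeff-+ []      r       k       = sym (ℚ.+-identityˡ (coeff r k))
coeff-+ (a ∷ p) []      k       = sym (ℚ.+-identityʳ (coeff (a ∷ p) k))
coeff-+ (a ∷ p) (b ∷ r) zero    = refl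
coeff-+ (a ∷ p) (b ∷ r) (suc k) = coeff-+ p r k

coeff-map : ∀ (g : ℚ → ℚ) → g 0ℚ ≡ 0ℚ → ∀ p k → coeff (map g p) k ≡ g (coeff p k)
coeff-map g g0 []      k       = sym g0
coeff-map g g0 (a ∷ p) zero    = refl
coeff-map g g0 (a ∷ p) (suc k) = coeff-map g g0 p k

coeff-· : ∀ c p k → coeff (c · p) k ≡ c ℚ.* coeff p k
coeff-· c = coeff-map (c ℚ.*_) (ℚ.*-zeroʳ c)

coeff-- : ∀ p r k → coeff (p - r) k ≡ coeff p k ℚ.- coeff r k
coeff-- p r k = trans (coeff-+ p (map ℚ.-_ r) k) (cong (λ x → coeff p k ℚ.+ x) (coeff-map ℚ.-_ refl r k))

-- The preceding coefficient of p is written as a coefficient of `0ℚ ∷ p`, so that k = 0 is no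
-- special case.
coeff-linear-* : ∀ a b p k → coeff ((a ∷ b ∷ []) * p) k ≡ a ℚ.* coeff p k ℚ.+ b ℚ.* coeff (0ℚ ∷ p) k
coeff-linear-* a b p k = trans (coeff-+ (a · p) _ k) (cong₂ ℚ._+_ (coeff-· a p k) (upper k))
  where
  coeff-0 : ∀ k → coeff (0ℚ ∷ []) k ≡ 0ℚ
  coeff-0 zero    = refl
  coeff-0 (suc k) = refl
  upper : ∀ k → coeff (0ℚ ∷ (b · p + (0ℚ ∷ []))) k ≡ b ℚ.* coeff (0ℚ ∷ p) k
  upper zero    = sym (ℚ.*-zeroʳ b)
  upper (suc k) = trans (coeff-+ (b · p) (0ℚ ∷ []) k)
    (trans (cong₂ ℚ._+_ (coeff-· b p k) (coeff-0 k)) (ℚ.+-identityʳ _))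

polyCommutativeMonoid : CommutativeMonoid 0ℓ 0ℓ
polyCommutativeMonoid = record
  { Carrier = Poly
  ; _≈_     = _≈_
  ; _∙_     = _+_
  ; ε       = []
  ; isCommutativeMonoid = record
    { isMonoid = record
      { isSemigroup = record
        { isMagma = record
          { isEquivalence = record
            { refl  = λ k → refl
            ; sym   = λ p≈r k → sym (p≈r k)
            ; trans = λ p≈r r≈s k → trans (p≈r k) (r≈s k)
            }
          ; ∙-cong = λ {p} {p′} {r} {r′} p≈p′ r≈r′ k →
              trans (coeff-+ p r k) (trans (cong₂ ℚ._+_ (p≈p′ k) (r≈r′ k)) (sym (coeff-+ p′ r′ k)))
          }
        ; assoc = λ p r s k → trans
            (trans (coeff-+ (p + r) s k) (cong (ℚ._+ coeff s k) (coeff-+ p r k)))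
            (trans (ℚ.+-assoc (coeff p k) (coeff r k) (coeff s k))
              (sym (trans (coeff-+ p (r + s) k) (cong (λ x → coeff p k ℚ.+ x) (coeff-+ r s k)))))
        }
      ; identity = (λ p k → refl) , λ p k → trans (coeff-+ p [] k) (ℚ.+-identityʳ (coeff p k))
      }
    ; comm = λ p r k → trans (coeff-+ p r k)
        (trans (ℚ.+-comm (coeff p k) (coeff r k)) (sym (coeff-+ r p k)))
    }
  }

open CommutativeMonoid polyCommutativeMonoid using (rawMonoid; setoid; ∙-cong; ∙-congˡ)
open Algebra.Properties.CommutativeMonoid.Mult polyCommutativeMonoid using (_×_; ×-congʳ; ×-assocˡ)

linear-*-homo : ∀ a b → IsMonoidHomomorphism rawMonoid rawMonoid ((a ∷ b ∷ []) *_)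
linear-*-homo a b = record
  { isMagmaHomomorphism = record
    { isRelHomomorphism = record
      { cong = λ {p} {r} p≈r k → trans (coeff-linear-* a b p k) (trans
          (cong₂ (λ x y → a ℚ.* x ℚ.+ b ℚ.* y) (p≈r k) (shifted p≈r k)) (sym (coeff-linear-* a b r k))) }
    ; homo = λ p r k → trans (coeff-linear-* a b (p + r) k)
        (trans (cong₂ (λ x y → a ℚ.* x ℚ.+ b ℚ.* y) (coeff-+ p r k) (coeff-+ (0ℚ ∷ p) (0ℚ ∷ r) k))
          (trans (distrib (coeff p k) (coeff r k) (coeff (0ℚ ∷ p) k) (coeff (0ℚ ∷ r) k))
            (sym (trans (coeff-+ ((a ∷ b ∷ []) * p) _ k)
              (cong₂ ℚ._+_ (coeff-linear-* a b p k) (coeff-linear-* a b r k))))))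
    }
  ; ε-homo = λ { zero → refl ; (suc zero) → refl ; (suc (suc k)) → refl }
  }
  where
  shifted : ∀ {p r} → p ≈ r → (0ℚ ∷ p) ≈ (0ℚ ∷ r)
  shifted p≈r zero    = refl
  shifted p≈r (suc k) = p≈r k
  distrib : ∀ x y x′ y′ → a ℚ.* (x ℚ.+ y) ℚ.+ b ℚ.* (x′ ℚ.+ y′) ≡
    (a ℚ.* x ℚ.+ b ℚ.* x′) ℚ.+ (a ℚ.* y ℚ.+ b ℚ.* y′)
  distrib = solve 6 (λ a b x y x′ y′ → a :* (x :+ y) :+ b :* (x′ :+ y′) :=
    (a :* x :+ b :* x′) :+ (a :* y :+ b :* y′)) refl a b
    where open +-*-Solver

-- The fraction bar of ℚ reduces to lowest terms, so identities with a variable numerator or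
-- denominator are checked on unnormalised fractions, where they are integer identities.
toℚᵘ-/1 : ∀ m → toℚᵘ (+ m / 1) ℚᵘ.≃ mkℚᵘ (+ m) 0
toℚᵘ-/1 m = ℚ.toℚᵘ-fromℚᵘ (mkℚᵘ (+ m) 0)

suc/1 : ∀ m → + suc m / 1 ≡ 1ℚ ℚ.+ (+ m / 1)
suc/1 m = ℚ.toℚᵘ-injective (begin
  toℚᵘ (+ suc m / 1)               ≈⟨ toℚᵘ-/1 (suc m) ⟩
  mkℚᵘ (+ suc m) 0                 ≈⟨ *≡* (cong (ℤ._* + 1) (sym (cong (λ i → + 1 ℤ.+ i) (ℤ.*-identityʳ (+ m))))) ⟩
  mkℚᵘ (+ 1) 0 ℚᵘ.+ mkℚᵘ (+ m) 0   ≈⟨ ℚᵘ.+-congʳ (mkℚᵘ (+ 1) 0) (toℚᵘ-/1 m) ⟨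
  toℚᵘ 1ℚ ℚᵘ.+ toℚᵘ (+ m / 1)      ≈⟨ ℚ.toℚᵘ-homo-+ 1ℚ (+ m / 1) ⟨
  toℚᵘ (1ℚ ℚ.+ (+ m / 1))          ∎)
  where open import Relation.Binary.Reasoning.Setoid ℚᵘ.≃-setoid

1/m*m/1 : ∀ m .{{_ : ℕ.NonZero m}} → (+ 1 / m) ℚ.* (+ m / 1) ≡ 1ℚ
1/m*m/1 (suc m) = ℚ.toℚᵘ-injective (begin
  toℚᵘ ((+ 1 / suc m) ℚ.* (+ suc m / 1))         ≈⟨ ℚ.toℚᵘ-homo-* (+ 1 / suc m) (+ suc m / 1) ⟩
  toℚᵘ (+ 1 / suc m) ℚᵘ.* toℚᵘ (+ suc m / 1)     ≈⟨ ℚᵘ.*-cong (ℚ.toℚᵘ-fromℚᵘ (mkℚᵘ (+ 1) m)) (toℚᵘ-/1 (suc m)) ⟩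
  mkℚᵘ (+ 1) m ℚᵘ.* mkℚᵘ (+ suc m) 0             ≈⟨ *≡* (ℤ.*-assoc (+ 1) (+ suc m) (+ 1)) ⟩
  mkℚᵘ (+ 1) 0                                   ∎)
  where open import Relation.Binary.Reasoning.Setoid ℚᵘ.≃-setoid

coeff-× : ∀ m p k → coeff (m × p) k ≡ (+ m / 1) ℚ.* coeff p k
coeff-× zero    p k = sym (ℚ.*-zeroˡ (coeff p k))
coeff-× (suc m) p k = begin
  coeff (p + m × p) k                                  ≡⟨ coeff-+ p (m × p) k ⟩
  coeff p k ℚ.+ coeff (m × p) k                        ≡⟨ cong (λ x → coeff p k ℚ.+ x) (coeff-× m p k) ⟩
  coeff p k ℚ.+ (+ m / 1) ℚ.* coeff p k                ≡⟨ cong (λ x → x ℚ.+ (+ m / 1) ℚ.* coeff p k) (ℚ.*-identityˡ (coeff p k)) ⟨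
  1ℚ ℚ.* coeff p k ℚ.+ (+ m / 1) ℚ.* coeff p k         ≡⟨ ℚ.*-distribʳ-+ (coeff p k) 1ℚ (+ m / 1) ⟨
  (1ℚ ℚ.+ (+ m / 1)) ℚ.* coeff p k                     ≡⟨ cong (ℚ._* coeff p k) (suc/1 m) ⟨
  (+ suc m / 1) ℚ.* coeff p k                          ∎
  where open ≡-Reasoning

-- This is q + m = (m + 1) + x with x = q - 1, read as an identity of operators on polynomials.
q+m-* : ∀ m p → (q + fromℕ m) * p ≈ suc m × p + (q - fromℕ 1) * p
q+m-* m p k = begin
  coeff ((q + fromℕ m) * p) k
    ≡⟨ coeff-linear-* (0ℚ ℚ.+ (+ m / 1)) 1ℚ p k ⟩
  (0ℚ ℚ.+ (+ m / 1)) ℚ.* x ℚ.+ 1ℚ ℚ.* y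
    ≡⟨ rearrange (+ m / 1) x y ⟩
  (1ℚ ℚ.+ (+ m / 1)) ℚ.* x ℚ.+ (ℚ.- 1ℚ ℚ.* x ℚ.+ 1ℚ ℚ.* y)
    ≡⟨ cong₂ ℚ._+_ (trans (coeff-× (suc m) p k) (cong (ℚ._* x) (suc/1 m))) (coeff-linear-* (ℚ.- 1ℚ) 1ℚ p k) ⟨
  coeff (suc m × p) k ℚ.+ coeff ((q - fromℕ 1) * p) k
    ≡⟨ coeff-+ (suc m × p) ((q - fromℕ 1) * p) k ⟨
  coeff (suc m × p + (q - fromℕ 1) * p) k
    ∎
  where
  open ≡-Reasoning
  x = coeff p k
  y = coeff (0ℚ ∷ p) k
  rearrange : ∀ m x y → (0ℚ ℚ.+ m) ℚ.* x ℚ.+ 1ℚ ℚ.* y ≡ (1ℚ ℚ.+ m) ℚ.* x ℚ.+ (ℚ.- 1ℚ ℚ.* x ℚ.+ 1ℚ ℚ.* y)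
  rearrange = solve 3 (λ m x y → (con 0ℚ :+ m) :* x :+ con 1ℚ :* y :=
    (con 1ℚ :+ m) :* x :+ (con (ℚ.- 1ℚ) :* x :+ con 1ℚ :* y)) refl
    where open +-*-Solver

q-* : ∀ p → q * p ≈ p + (q - fromℕ 1) * p
q-* p k = begin
  coeff (q * p) k
    ≡⟨ coeff-linear-* 0ℚ 1ℚ p k ⟩
  0ℚ ℚ.* x ℚ.+ 1ℚ ℚ.* y
    ≡⟨ rearrange x y ⟩
  x ℚ.+ (ℚ.- 1ℚ ℚ.* x ℚ.+ 1ℚ ℚ.* y)
    ≡⟨ cong (λ z → x ℚ.+ z) (coeff-linear-* (ℚ.- 1ℚ) 1ℚ p k) ⟨
  x ℚ.+ coeff ((q - fromℕ 1) * p) k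
    ≡⟨ coeff-+ p ((q - fromℕ 1) * p) k ⟨
  coeff (p + (q - fromℕ 1) * p) k
    ∎
  where
  open ≡-Reasoning
  x = coeff p k
  y = coeff (0ℚ ∷ p) k
  rearrange : ∀ x y → 0ℚ ℚ.* x ℚ.+ 1ℚ ℚ.* y ≡ x ℚ.+ (ℚ.- 1ℚ ℚ.* x ℚ.+ 1ℚ ℚ.* y)
  rearrange = solve 2 (λ x y → con 0ℚ :* x :+ con 1ℚ :* y :=
    x :+ (con (ℚ.- 1ℚ) :* x :+ con 1ℚ :* y)) refl
    where open +-*-Solver

q-1-*-homo : IsMonoidHomomorphism rawMonoid rawMonoid ((q - fromℕ 1) *_)
q-1-*-homo = linear-*-homo (ℚ.- 1ℚ) 1ℚ

open IsMonoidHomomorphism q-1-*-homo using () renaming (⟦⟧-cong to q-1-*-cong)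

open Sums polyCommutativeMonoid
  using (⟦_⟧; ⟦⟧-true; ⟦⟧-false; ⟦⟧-congˡ; ⟦⟧-congʳ; ∑-cong-∈; ∑-filter; ∑-single; markedSum-orbit; module WordSums)
open WordsSum polyCommutativeMonoid using (words-∷; 1+X; 1+X-homo; ⟦⟧-fold; ∑-words≈markedSum)
open Rotations using (module Rotation)

q^≈fold : ∀ m → q ^ m ≈ fold (const 1ℚ) (1+X q-1-*-homo) m
q^≈fold zero    = λ k → refl
q^≈fold (suc m) = begin
  q * q ^ m                              ≈⟨ q-* (q ^ m) ⟩
  1+X q-1-*-homo (q ^ m)                 ≈⟨ IsMonoidHomomorphism.⟦⟧-cong (1+X-homo q-1-*-homo) {q ^ m} {p} (q^≈fold m) ⟩
  1+X q-1-*-homo p                       ∎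
  where
  open import Relation.Binary.Reasoning.Setoid setoid
  p = fold (const 1ℚ) (1+X q-1-*-homo) m

[q-1]^≡fold : ∀ m → (q - fromℕ 1) ^ m ≡ fold (const 1ℚ) ((q - fromℕ 1) *_) m
[q-1]^≡fold zero    = refl
[q-1]^≡fold (suc m) = cong ((q - fromℕ 1) *_) ([q-1]^≡fold m)

[q+n]^≈fold : ∀ n m → (q + fromℕ n) ^ m ≈ fold (const 1ℚ) (λ p → suc n × p + (q - fromℕ 1) * p) m
[q+n]^≈fold n zero    = λ k → refl
[q+n]^≈fold n (suc m) = begin
  (q + fromℕ n) * p                     ≈⟨ q+m-* n p ⟩
  suc n × p + (q - fromℕ 1) * p         ≈⟨ ∙-cong {suc n × p} {suc n × p′} {(q - fromℕ 1) * p} {(q - fromℕ 1) * p′}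
                                             (×-congʳ (suc n) {p} {p′} IH) (q-1-*-cong {p} {p′} IH) ⟩
  suc n × p′ + (q - fromℕ 1) * p′       ∎
  where
  open import Relation.Binary.Reasoning.Setoid setoid
  p = (q + fromℕ n) ^ m
  p′ = fold (const 1ℚ) (λ p → suc n × p + (q - fromℕ 1) * p) m
  IH = [q+n]^≈fold n m

-- Application to the indicator of parking words

module _ (n : ℕ) where

  open Rotation n
  open WordSums (upTo (suc n))
  open Marked q-1-*-homo

  parkingIndicator : List ℕ → Poly
  parkingIndicator w = ⟦ parking? w ⟧ (const 1ℚ)

  parkingIndicator-sym : Symmetric parkingIndicator
  parkingIndicator-sym {v} {w} v↭w =
    ⟦⟧-congˡ (parking? v) (parking? w) (parking-↭ v↭w) (parking-↭ (↭-sym v↭w)) (const 1ℚ)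

  letters≤n : ∀ {w} → All (_∈ upTo (suc n)) w → All (_≤ n) w
  letters≤n = All.map (ℕ.≤-pred ∘ ∈-upTo⁻)

  parkingIndicator-zero : ∀ {w} → All (_∈ upTo (suc n)) w → suc (length w) ≡ n →
    parkingIndicator (0 ∷ w) ≈ []
  parkingIndicator-zero {w} w∈ eq =
    ⟦⟧-false (parking? (0 ∷ w)) (parking-zero (letters≤n w∈) eq) (const 1ℚ)

  parkingIndicator-orbit : ∀ {w} → All (_∈ upTo (suc n)) w → length w ≡ n →
    ∑ (upTo (suc n)) (λ t → parkingIndicator (rotateⁿ t w)) ≈ const 1ℚ
  parkingIndicator-orbit {w} w∈ ∣w∣≡n with exists-parking-rotation (letters≤n w∈) ∣w∣≡n
  ... | t , t≤n , p = begin
    ∑ (upTo (suc n)) (λ t → parkingIndicator (rotateⁿ t w))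
      ≈⟨ ∑-single (λ t → parkingIndicator (rotateⁿ t w)) (Uniqueₚ.upTo⁺ (suc n)) (∈-upTo⁺ (ℕ.s≤s t≤n)) others ⟩
    parkingIndicator (rotateⁿ t w)
      ≈⟨ ⟦⟧-true (parking? (rotateⁿ t w)) p (const 1ℚ) ⟩
    const 1ℚ
      ∎
    where
    open import Relation.Binary.Reasoning.Setoid setoid
    others : ∀ {u} → u ∈ upTo (suc n) → u ≢ t → parkingIndicator (rotateⁿ u w) ≈ []
    others {u} u∈ u≢t = ⟦⟧-false (parking? (rotateⁿ u w))
      (λ r → u≢t (parking-rotation-unique (letters≤n w∈) ∣w∣≡n (ℕ.≤-pred (∈-upTo⁻ u∈)) t≤n r p)) (const 1ℚ)

  ∑-PF≈markedSum : ∑ (PF n) (λ π → q ^ fix π) ≈ markedSum (applyUpTo suc n) parkingIndicator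
  ∑-PF≈markedSum = begin
    ∑ (PF n) (λ π → q ^ fix π)
      ≈⟨ ∑-filter isParkingFunction? (words (applyUpTo suc n) n) (λ π → q ^ fix π) ⟩
    ∑ (words (applyUpTo suc n) n) weight
      ≈⟨ words-∷ 0 (applyUpTo suc n) n {weight} (λ {π} 0∈π →
           ⟦⟧-false (isParkingFunction? π) (λ pf → contradiction (VecAll.lookup (positive pf) 0∈π) λ ()) (q ^ fix π)) ⟩
    ∑ (words (upTo (suc n)) n) weight
      ≈⟨ ∑-cong-∈ (words (upTo (suc n)) n) {weight} {weight′} (λ {π} π∈ → weight≈ π (letters≤n (∈-words⁻ n π∈))) ⟩
    ∑ (words (upTo (suc n)) n) weight′
      ≈⟨ ∑-words≈markedSum q-1-*-homo (Uniqueₚ.upTo⁺ (suc n)) suc n parkingIndicator (∈-upTo⁺ ∘ ℕ.s≤s) ⟩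
    markedSum (applyUpTo suc n) parkingIndicator
      ∎
    where
    open import Relation.Binary.Reasoning.Setoid setoid
    weight weight′ : Vec ℕ n → Poly
    weight  π = ⟦ isParkingFunction? π ⟧ (q ^ fix π)
    weight′ π = fold (parkingIndicator (toList π)) (1+X q-1-*-homo) (agreements suc π)

    weight≈ : ∀ π → All (_≤ n) (toList π) → weight π ≈ weight′ π
    weight≈ π π≤n = begin
      ⟦ isParkingFunction? π ⟧ (q ^ fix π)
        ≡⟨ cong (λ m → ⟦ isParkingFunction? π ⟧ (q ^ m)) (fix≡agreements π) ⟩
      ⟦ isParkingFunction? π ⟧ (q ^ m)
        ≈⟨ ⟦⟧-congʳ (isParkingFunction? π) {q ^ m} {fold (const 1ℚ) (1+X q-1-*-homo) m} (q^≈fold m) ⟩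
      ⟦ isParkingFunction? π ⟧ (fold (const 1ℚ) (1+X q-1-*-homo) m)
        ≈⟨ ⟦⟧-congˡ (isParkingFunction? π) (parking? (toList π))
             isParkingFunction⇒parking (parking⇒isParkingFunction π≤n) _ ⟩
      ⟦ parking? (toList π) ⟧ (fold (const 1ℚ) (1+X q-1-*-homo) m)
        ≈⟨ ⟦⟧-fold q-1-*-homo (parking? (toList π)) (const 1ℚ) m ⟩
      weight′ π
        ∎
      where m = agreements suc π

  orbit-identity : suc n × (suc n × ∑ (PF n) (λ π → q ^ fix π)) + (q - fromℕ 1) ^ suc n ≈ (q + fromℕ n) ^ suc n
  orbit-identity = begin
    N × (N × ∑ (PF n) (λ π → q ^ fix π)) + (q - fromℕ 1) ^ N
      ≈⟨ ∙-cong {N × (N × lhs)} {N × (N × marked)} {(q - fromℕ 1) ^ N} {foldX N}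
           (×-congʳ N {N × lhs} {N × marked} (×-congʳ N {lhs} {marked} ∑-PF≈markedSum))
           (λ k → cong (λ p → coeff p k) ([q-1]^≡fold N)) ⟩
    N × (N × marked) + foldX N
      -- The averaging identity speaks of the length of the list 1,...,n, which equals n only
      -- propositionally.
      ≈⟨ ≡.subst (λ m → suc m × (suc m × marked) + foldX (suc m) ≈
                         fold (const 1ℚ) (λ p → suc m × p + (q - fromℕ 1) * p) (suc m))
           ∣is∣≡n orbit ⟩
    fold (const 1ℚ) (λ p → N × p + (q - fromℕ 1) * p) N
      ≈⟨ [q+n]^≈fold n N ⟨
    (q + fromℕ n) ^ N
      ∎
    where
    open import Relation.Binary.Reasoning.Setoid setoid
    N = suc n
    is = applyUpTo suc n
    lhs = ∑ (PF n) (λ π → q ^ fix π)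
    marked = markedSum is parkingIndicator
    foldX = fold (const 1ℚ) ((q - fromℕ 1) *_)
    ∣is∣≡n : length is ≡ n
    ∣is∣≡n = length-applyUpTo suc n
    orbit : suc (length is) × (suc (length is) × marked) + foldX (suc (length is)) ≈
      fold (const 1ℚ) (λ p → suc (length is) × p + (q - fromℕ 1) * p) (suc (length is))
    orbit = markedSum-orbit q-1-*-homo 0 is map-rotate-upTo {parkingIndicator} parkingIndicator-sym {const 1ℚ}
      (λ w∈ eq → parkingIndicator-zero w∈ (trans eq ∣is∣≡n))
      (λ {w} w∈ eq → ≡.subst (λ m → ∑ (upTo (suc m)) (λ t → parkingIndicator (rotateⁿ t w)) ≈ const 1ℚ)
        (sym ∣is∣≡n) (parkingIndicator-orbit w∈ (trans eq ∣is∣≡n)))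

theorem2p2 : (n : ℕ) → 1 ≤ n →
    ∑ (PF n) (λ π → q ^ fix π) ≈ (+ 1 / (suc n ℕ.^ 2)) · ((q + fromℕ n) ^ suc n - (q - fromℕ 1) ^ suc n)
theorem2p2 n _ k = begin
  x                               ≡⟨ ℚ.*-identityˡ x ⟨
  1ℚ ℚ.* x                        ≡⟨ cong (ℚ._* x) (1/m*m/1 (N ℕ.^ 2)) ⟨
  -- Adding and subtracting b, the coefficient of (q - 1)^(n+1), turns the additive identity into
  -- the required difference.
  (c ℚ.* d) ℚ.* x                 ≡⟨ rearrange c d x b ⟩
  c ℚ.* ((d ℚ.* x ℚ.+ b) ℚ.- b)   ≡⟨ cong (λ y → c ℚ.* (y ℚ.- b)) scaled ⟩
  c ℚ.* (a ℚ.- b)                 ≡⟨ cong (c ℚ.*_) (coeff-- ((q + fromℕ n) ^ N) ((q - fromℕ 1) ^ N) k) ⟨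
  c ℚ.* coeff ((q + fromℕ n) ^ N - (q - fromℕ 1) ^ N) k
                                  ≡⟨ coeff-· c ((q + fromℕ n) ^ N - (q - fromℕ 1) ^ N) k ⟨
  coeff (c · ((q + fromℕ n) ^ N - (q - fromℕ 1) ^ N)) k ∎
  where
  open ≡-Reasoning
  N = suc n
  lhs = ∑ (PF n) (λ π → q ^ fix π)
  x = coeff lhs k
  a = coeff ((q + fromℕ n) ^ N) k
  b = coeff ((q - fromℕ 1) ^ N) k
  c = + 1 / (N ℕ.^ 2)
  d = + (N ℕ.^ 2) / 1

  rearrange : ∀ c d x b → (c ℚ.* d) ℚ.* x ≡ c ℚ.* ((d ℚ.* x ℚ.+ b) ℚ.- b)
  rearrange = solve 4 (λ c d x b → (c :* d) :* x := c :* ((d :* x :+ b) :- b)) refl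
    where open +-*-Solver

  scaled : d ℚ.* x ℚ.+ b ≡ a
  scaled = begin
    d ℚ.* x ℚ.+ b                            ≡⟨ cong (ℚ._+ b) (coeff-× (N ℕ.^ 2) lhs k) ⟨
    -- `N ℕ.^ 2` unfolds to N times (N times 1), so only the last factor has to be removed.
    coeff ((N ℕ.^ 2) × lhs) k ℚ.+ b          ≡⟨ cong (λ m → coeff ((N ℕ.* m) × lhs) k ℚ.+ b) (ℕ.*-identityʳ N) ⟩
    coeff ((N ℕ.* N) × lhs) k ℚ.+ b          ≡⟨ cong (ℚ._+ b) (×-assocˡ lhs N N k) ⟨
    coeff (N × (N × lhs)) k ℚ.+ b            ≡⟨ coeff-+ (N × (N × lhs)) ((q - fromℕ 1) ^ N) k ⟨
    coeff (N × (N × lhs) + (q - fromℕ 1) ^ N) k ≡⟨ orbit-identity n k ⟩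
    a                                        ∎
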